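{- Let $d$ and $n$ be positive integers, and let $w_d(n)=\nu_2(W_d(n))$, where $W_d(n)$ is the number of $2n$-step walks in $\mathbb{Z}^d$ that begin and end at the origin, each step being a move by one of the $2d$ vectors $\pm \mathbf{e}_1,\dots,\pm\mathbf{e}_d$. Let $s_2(n)$ be the number of $1$s in the binary expansion of $n$. Then: (a) If $\nu_2(d)=0$, then $w_d(n)=s_2(n)$. (b) If $\nu_2(d)=1$, then $w_d(n)=2s_2(n)$. (c) If $\nu_2(d)=2$, then $w_d(n)\ge 3s_2(n)$, with equality if and only if the binary expansion of $n$ does not contain two adjacent $1$s. (d) If $\nu_2(d)\ge 3$, let $\delta=\nu_2(d)-2$. Then $w_d(n)\ge 3s_2(n)+\delta$, with equality if and only if, in the binary expansion of $n$, all of the $1$s come before all of the $0$s.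
   Context: $\nu_2(x)$ denotes the exponent of $2$ in the prime factorisation of a positive integer $x$. The binary expansion of $n$ is written without leading zeroes. -}

module Defs where

open import Data.Nat using (ℕ; zero; suc; _+_; _*_; ⌊_/2⌋)
open import Data.Bool using (Bool; true; false; not; if_then_else_)
open import Data.Fin using (Fin)
open import Data.Fin.Properties using () renaming (_≟_ to _≟F_)
open import Data.Integer using (ℤ; +_; -[1+_]) renaming (_+_ to _+ℤ_)
open import Data.Integer.Properties using () renaming (_≟_ to _≟ℤ_)
open import Data.List using (List; []; _∷_; _++_; map; concatMap; length; filter; cartesianProduct; allFin; reverse; replicate; foldr)
open import Data.Vec using (Vec; tabulate; zipWith) renaming (replicate to vreplicate)
open import Data.Vec.Properties using (≡-dec)
open import Data.Product using (_×_; _,_; Σ; ∃₂)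
open import Relation.Nullary using (Dec; yes; no; does; ¬_)
open import Relation.Binary.PropositionalEquality using (_≡_)
open import Data.Bool.Properties using () renaming (_≟_ to _≟B_)

-- A step is ±e_i : (i , true) means +e_i, (i , false) means -e_i.
Step : ℕ → Set
Step d = Fin d × Bool

allSteps : (d : ℕ) → List (Step d)
allSteps d = cartesianProduct (allFin d) (true ∷ false ∷ [])

stepVec : {d : ℕ} → Step d → Vec ℤ d
stepVec (i , b) = tabulate λ j →
  if does (j ≟F i) then (if b then + 1 else -[1+ 0 ]) else + 0

walks : (d k : ℕ) → List (List (Step d))
walks d zero    = [] ∷ []
walks d (suc k) = concatMap (λ s → map (s ∷_) (walks d k)) (allSteps d)

origin : (d : ℕ) → Vec ℤ d
origin d = vreplicate d (+ 0)

endpoint : {d : ℕ} → List (Step d) → Vec ℤ d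
endpoint {d} = foldr (λ s v → zipWith _+ℤ_ (stepVec s) v) (origin d)

W : ℕ → ℕ → ℕ
W d n = length (filter (λ w → ≡-dec _≟ℤ_ (endpoint w) (origin d)) (walks d (2 * n)))

odd : ℕ → Bool
odd zero    = false
odd (suc n) = not (odd n)

-- ν₂ x for x > 0 (fuel x suffices since ν₂ x ≤ x); ν₂ 0 = 0 by convention
ν₂-go : ℕ → ℕ → ℕ
ν₂-go zero    _       = zero
ν₂-go (suc f) zero    = zero
ν₂-go (suc f) (suc m) = if odd (suc m) then zero else suc (ν₂-go f ⌊ suc m /2⌋)

ν₂ : ℕ → ℕ
ν₂ x = ν₂-go x x

-- little-endian binary digits (true = 1), no trailing (i.e. leading) zeros
bitsLE-go : ℕ → ℕ → List Bool
bitsLE-go zero    _       = []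
bitsLE-go (suc f) zero    = []
bitsLE-go (suc f) (suc m) = odd (suc m) ∷ bitsLE-go f ⌊ suc m /2⌋

binary : ℕ → List Bool
binary n = reverse (bitsLE-go n n)

s₂ : ℕ → ℕ
s₂ n = length (filter (λ b → b ≟B true) (binary n))

NoAdjacentOnes : ℕ → Set
NoAdjacentOnes n = ¬ (∃₂ λ xs ys → binary n ≡ xs ++ (true ∷ true ∷ ys))

OnesBeforeZeros : ℕ → Set
OnesBeforeZeros n = ∃₂ λ a b → binary n ≡ replicate a true ++ replicate b false

{-# OPTIONS --safe #-}

-- Write A_d(m) for the number of closed m-step walks in ℤ^d. Since a walk in ℤ^(a+b) is a shuffle of
-- walks in ℤ^a and ℤ^b, A_(a+b) is the binomial convolution A_a ⋆ A_b. Let b(i,j) = C(i+j,i).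
-- By Kummer's theorem ν₂ b(i,j) = s₂(i) + s₂(j) − s₂(i+j), so if 2^(c s₂(n)) divides W_a(n) and W_b(n)
-- for some c ≥ 1, it divides W_(a+b)(n) too, and the quotients modulo 2 are again combined by ⋆.
-- As f ⋆ f ≡ δ₀ (mod 2) whenever f(0) is odd, multiplying d by an odd number does not change the
-- residue. This reduces (a), (b), (c) to d = 1, 2, 4, where W_1(n) = b(n,n), W_2(n) = b(n,n)², and
--   W_4(n) = b(n,n) Σ_j 4^(n−2j) b(n,j) C(n,2j) b(j,j)²,
-- obtained from MacMahon's expansion of Σ C(n,k)³ x^k y^(n−k) in powers of xy and x+y. Only
-- j = ⌊n/2⌋ can contribute the minimal valuation 3 s₂(n), with odd quotient iff b(n,⌊n/2⌋) is odd.
-- For (d), the product rule gives W_(2a)(n+1) = 2 Σ_(i+j=n) b(2i+1,2j) W_a(i+1) W_a(j). From 4u to 8u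
-- (u odd) the residue of the sum counts, up to exchanging the two colours, the 2-colourings of the
-- 1s of n+1 in which adjacent 1s differ, and this number is odd iff the 1s form a single run; each
-- further doubling of d only contributes a factor 2.

module Submission where

open import Defs
open import Data.Bool using (Bool; true; false; not; if_then_else_; _∧_; _xor_)
open import Data.Bool.Properties using (not-distribˡ-xor; xor-same; ∧-idem; ∧-identityʳ) renaming (_≟_ to _≟B_)
open import Data.Empty using (⊥-elim)
open import Data.Fin using (zero; suc)
open import Data.Integer using (ℤ; -[1+_]; _⊖_) renaming (+_ to pos; _+_ to _+ℤ_)
open import Data.Integer.Properties using (distribʳ-⊖-+-pos; distribʳ-⊖-+-neg; m-n≡m⊖n; i-j≡0⇒i≡j; n⊖n≡0) renaming (_≟_ to _≟ℤ_; +-identityˡ to +ℤ-identityˡ; +-injective to +ℤ-injective)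
open import Data.List using (List; []; _∷_; _++_; map; concatMap; length; filter; cartesianProduct; allFin; reverse; replicate)
open import Data.List.Properties using (map-tabulate; map-++; map-∘; map-cong; filter-++; length-++; ++-assoc; reverse-++; reverse-involutive; unfold-reverse)
open import Data.Nat
open import Data.Nat.Combinatorics using (_C_; nCn≡1; k>n⇒nCk≡0; nCk+nC[k+1]≡[n+1]C[k+1])
open import Data.Nat.ListAction using (sum)
open import Data.Nat.ListAction.Properties using (sum-++)
open import Data.Nat.Properties
open import Data.Nat.Tactic.RingSolver using (solve-∀)
open import Data.Product using (_×_; _,_; ∃; ∃₂; proj₁; proj₂)
open import Data.Sum using (_⊎_; inj₁; inj₂)
open import Data.Vec using (Vec; []; _∷_; zipWith; tabulate)
open import Data.Vec.Properties using (≡-dec)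
open import Function.Bundles using (_⇔_; mk⇔)
open import Function.Construct.Composition using (_⇔-∘_)
open import Relation.Binary.PropositionalEquality
open import Relation.Nullary using (Dec; yes; no; does)
open import Relation.Nullary.Decidable using (dec-true; dec-false)
open ≡-Reasoning

-- Binomial sums

-- The obstacle is dimension four. In the convolution of `W 2` with itself the summand for i + j = n
-- has valuation 2 s₂(n) + 3 ν₂ b(i,j), so the 2^(s₂(n)) carry-free pairs all tie at 2 s₂(n), and
-- the bound 3 s₂(n) comes from a cancellation between them that no termwise estimate sees.
-- MacMahon's expansion rearranges the sum so that each new summand reaches 3 s₂(n) by itself. In
-- (d) the rule f ⋆ f ≡ δ₀ only says that the quotient is even at positive arguments, not what
-- remains after halving it. The product rule takes out the factor 2 as an identity of integers,
-- before anything is reduced modulo 2. Sequences are treated as exponential generating functions: ⋆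
-- is the product and the shift is the derivative. Two forms of the same sum serve this: `binSum`
-- follows the product rule and suits identities, while `antiSum` displays the binomial weights and
-- suits valuations.

binom : ℕ → ℕ → ℕ
binom i j = (i + j) C i

binom-zeroʳ : ∀ i → binom i 0 ≡ 1
binom-zeroʳ i rewrite +-identityʳ i = nCn≡1 i

binom-pascal : ∀ i j → binom (suc i) (suc j) ≡ binom i (suc j) + binom (suc i) j
binom-pascal i j = begin
  suc (i + suc j) C suc i                  ≡⟨ nCk+nC[k+1]≡[n+1]C[k+1] (i + suc j) i ⟨
  (i + suc j) C i + (i + suc j) C suc i    ≡⟨ cong (λ m → (i + suc j) C i + m C suc i) (+-suc i j) ⟩
  (i + suc j) C i + suc (i + j) C suc i    ∎

binom-comm : ∀ i j → binom i j ≡ binom j i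
binom-comm zero j = sym (binom-zeroʳ j)
binom-comm (suc i) zero = binom-zeroʳ (suc i)
binom-comm (suc i) (suc j) = begin
  binom (suc i) (suc j)               ≡⟨ binom-pascal i j ⟩
  binom i (suc j) + binom (suc i) j   ≡⟨ cong₂ _+_ (binom-comm i (suc j)) (binom-comm (suc i) j) ⟩
  binom (suc j) i + binom j (suc i)   ≡⟨ +-comm (binom (suc j) i) _ ⟩
  binom j (suc i) + binom (suc j) i   ≡⟨ binom-pascal j i ⟨
  binom (suc j) (suc i)               ∎

binom-positive : ∀ i j → 1 ≤ binom i j
binom-positive zero j = ≤-refl
binom-positive (suc i) zero = ≤-reflexive (sym (binom-zeroʳ (suc i)))
binom-positive (suc i) (suc j) = subst (1 ≤_) (sym (binom-pascal i j)) (m≤n⇒m≤n+o _ (binom-positive i (suc j)))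

binom-! : ∀ i j → binom i j * (i ! * j !) ≡ (i + j) !
binom-! zero j = trans (*-identityˡ (1 * j !)) (*-identityˡ (j !))
binom-! (suc i) zero rewrite binom-zeroʳ (suc i) | +-identityʳ i =
  trans (*-identityˡ _) (*-identityʳ _)
binom-! (suc i) (suc j) = begin
  binom (suc i) (suc j) * (suc i ! * suc j !)
    ≡⟨ cong (_* (suc i ! * suc j !)) (binom-pascal i j) ⟩
  (x + y) * ((suc i * i !) * (suc j * j !))
    ≡⟨ expand x y i j (i !) (j !) ⟩
  suc i * (x * (i ! * (suc j * j !))) + suc j * (y * ((suc i * i !) * j !))
    ≡⟨ cong₂ (λ a b → suc i * a + suc j * b) (binom-! i (suc j))
         (trans (binom-! (suc i) j) (cong _! (sym (+-suc i j)))) ⟩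
  suc i * (i + suc j) ! + suc j * (i + suc j) !
    ≡⟨ *-distribʳ-+ ((i + suc j) !) (suc i) (suc j) ⟨
  (suc i + suc j) ! ∎
  where
  x = binom i (suc j)
  y = binom (suc i) j
  expand : ∀ x y i j a b → (x + y) * ((suc i * a) * (suc j * b))
         ≡ suc i * (x * (a * (suc j * b))) + suc j * (y * ((suc i * a) * b))
  expand = solve-∀

antiSum : (ℕ → ℕ → ℕ) → ℕ → ℕ
antiSum F zero    = F 0 0
antiSum F (suc n) = F 0 (suc n) + antiSum (λ i j → F (suc i) j) n

antiSum-sucʳ : ∀ F n → antiSum F (suc n) ≡ antiSum (λ i j → F i (suc j)) n + F (suc n) 0
antiSum-sucʳ F zero = refl
antiSum-sucʳ F (suc n) = begin
  F 0 (2 + n) + antiSum (λ i j → F (suc i) j) (suc n)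
    ≡⟨ cong (F 0 (2 + n) +_) (antiSum-sucʳ (λ i j → F (suc i) j) n) ⟩
  F 0 (2 + n) + (antiSum (λ i j → F (suc i) (suc j)) n + F (2 + n) 0)
    ≡⟨ +-assoc (F 0 (2 + n)) _ _ ⟨
  antiSum (λ i j → F i (suc j)) (suc n) + F (2 + n) 0 ∎

antiSum-ends : ∀ F n → antiSum F (2 + n) ≡ F 0 (2 + n) + (antiSum (λ i j → F (suc i) (suc j)) n + F (2 + n) 0)
antiSum-ends F n = cong (F 0 (2 + n) +_) (antiSum-sucʳ (λ i j → F (suc i) j) n)

antiSum-cong : ∀ {F G} n → (∀ i j → i + j ≡ n → F i j ≡ G i j) → antiSum F n ≡ antiSum G n
antiSum-cong zero h = h 0 0 refl
antiSum-cong (suc n) h =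
  cong₂ _+_ (h 0 (suc n) refl) (antiSum-cong n (λ i j eq → h (suc i) j (cong suc eq)))

antiSum-zero : ∀ {F} n → (∀ i j → i + j ≡ n → F i j ≡ 0) → antiSum F n ≡ 0
antiSum-zero zero h = h 0 0 refl
antiSum-zero (suc n) h =
  cong₂ _+_ (h 0 (suc n) refl) (antiSum-zero n (λ i j eq → h (suc i) j (cong suc eq)))

antiSum-+ : ∀ F G n → antiSum (λ i j → F i j + G i j) n ≡ antiSum F n + antiSum G n
antiSum-+ F G zero = refl
antiSum-+ F G (suc n) rewrite antiSum-+ (λ i j → F (suc i) j) (λ i j → G (suc i) j) n =
  swap (F 0 (suc n)) (G 0 (suc n)) _ _
  where
  swap : ∀ a b c d → (a + b) + (c + d) ≡ (a + c) + (b + d)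
  swap = solve-∀

antiSum-*ˡ : ∀ c F n → antiSum (λ i j → c * F i j) n ≡ c * antiSum F n
antiSum-*ˡ c F zero = refl
antiSum-*ˡ c F (suc n) rewrite antiSum-*ˡ c (λ i j → F (suc i) j) n =
  sym (*-distribˡ-+ c (F 0 (suc n)) _)

-- Leibniz form of the binomial sum: iterating the product rule n times produces
-- each F i j with multiplicity binom i j.
binSum : (ℕ → ℕ → ℕ) → ℕ → ℕ
binSum F zero    = F 0 0
binSum F (suc n) = binSum (λ i j → F (suc i) j) n + binSum (λ i j → F i (suc j)) n

-- Pascal's rule merges the two halves of the recursion only where both indices are positive; the
-- ends i = 0 and j = 0 are split off, which requires at least two terms and makes 1 a separate
-- case.
binSum≡antiSum : ∀ F n → binSum F n ≡ antiSum (λ i j → binom i j * F i j) n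
binSum≡antiSum F zero = sym (*-identityˡ (F 0 0))
binSum≡antiSum F (suc zero) = swap (F 1 0) (F 0 1)
  where
  swap : ∀ x y → x + y ≡ 1 * y + 1 * x
  swap = solve-∀
binSum≡antiSum F (suc (suc n)) = begin
  binSum (λ i j → F (suc i) j) (suc n) + binSum (λ i j → F i (suc j)) (suc n)
    ≡⟨ cong₂ _+_ (binSum≡antiSum (λ i j → F (suc i) j) (suc n)) (binSum≡antiSum (λ i j → F i (suc j)) (suc n)) ⟩
  antiSum (λ i j → binom i j * F (suc i) j) (suc n) + antiSum (λ i j → binom i j * F i (suc j)) (suc n)
    ≡⟨ cong (_+ antiSum (λ i j → binom i j * F i (suc j)) (suc n)) (antiSum-sucʳ (λ i j → binom i j * F (suc i) j) n) ⟩
  (X + binom (suc n) 0 * F (2 + n) 0) + (1 * F 0 (2 + n) + Y)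
    ≡⟨ cong (λ t → (X + t * F (2 + n) 0) + (1 * F 0 (2 + n) + Y))
         (trans (binom-zeroʳ (suc n)) (sym (binom-zeroʳ (2 + n)))) ⟩
  (X + binom (2 + n) 0 * F (2 + n) 0) + (1 * F 0 (2 + n) + Y)
    ≡⟨ shuffle X (binom (2 + n) 0 * F (2 + n) 0) (1 * F 0 (2 + n)) Y ⟩
  1 * F 0 (2 + n) + ((X + Y) + binom (2 + n) 0 * F (2 + n) 0)
    ≡⟨ cong (λ t → 1 * F 0 (2 + n) + (t + binom (2 + n) 0 * F (2 + n) 0)) (sym (antiSum-+ _ _ n)) ⟩
  1 * F 0 (2 + n) + (antiSum (λ i j → binom i (suc j) * F (suc i) (suc j) + binom (suc i) j * F (suc i) (suc j)) n + binom (2 + n) 0 * F (2 + n) 0)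
    ≡⟨ cong (λ t → 1 * F 0 (2 + n) + (t + binom (2 + n) 0 * F (2 + n) 0)) (antiSum-cong n (λ i j _ →
         trans (sym (*-distribʳ-+ (F (suc i) (suc j)) (binom i (suc j)) (binom (suc i) j)))
               (cong (_* F (suc i) (suc j)) (sym (binom-pascal i j))))) ⟩
  1 * F 0 (2 + n) + (antiSum (λ i j → binom (suc i) (suc j) * F (suc i) (suc j)) n + binom (2 + n) 0 * F (2 + n) 0)
    ≡⟨ antiSum-ends (λ i j → binom i j * F i j) n ⟨
  antiSum (λ i j → binom i j * F i j) (2 + n) ∎
  where
  X = antiSum (λ i j → binom i (suc j) * F (suc i) (suc j)) n
  Y = antiSum (λ i j → binom (suc i) j * F (suc i) (suc j)) n
  shuffle : ∀ x y z w → (x + y) + (z + w) ≡ z + ((x + w) + y)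
  shuffle = solve-∀

binSum-cong : ∀ {F G} → (∀ i j → F i j ≡ G i j) → ∀ n → binSum F n ≡ binSum G n
binSum-cong h zero    = h 0 0
binSum-cong h (suc n) =
  cong₂ _+_ (binSum-cong (λ i j → h (suc i) j) n) (binSum-cong (λ i j → h i (suc j)) n)

binSum-+ : ∀ F G n → binSum (λ i j → F i j + G i j) n ≡ binSum F n + binSum G n
binSum-+ F G zero = refl
binSum-+ F G (suc n)
  rewrite binSum-+ (λ i j → F (suc i) j) (λ i j → G (suc i) j) n
        | binSum-+ (λ i j → F i (suc j)) (λ i j → G i (suc j)) n =
  swap (binSum (λ i j → F (suc i) j) n) (binSum (λ i j → G (suc i) j) n) _ _
  where
  swap : ∀ a b c d → (a + b) + (c + d) ≡ (a + c) + (b + d)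
  swap = solve-∀

binSum-flip : ∀ F n → binSum (λ i j → F j i) n ≡ binSum F n
binSum-flip F zero = refl
binSum-flip F (suc n) =
  trans (cong₂ _+_ (binSum-flip (λ i j → F i (suc j)) n) (binSum-flip (λ i j → F (suc i) j) n))
        (+-comm (binSum (λ i j → F i (suc j)) n) _)

infixl 7 _⋆_
-- The product of exponential generating functions. At `suc n` it unfolds by definition to the
-- product rule for the derivative `λ i → f (suc i)`.
_⋆_ : (ℕ → ℕ) → (ℕ → ℕ) → ℕ → ℕ
f ⋆ g = binSum (λ i j → f i * g j)

⋆-cong : ∀ {f f′ g g′} → (∀ i → f i ≡ f′ i) → (∀ j → g j ≡ g′ j) → ∀ n → (f ⋆ g) n ≡ (f′ ⋆ g′) n
⋆-cong hf hg = binSum-cong (λ i j → cong₂ _*_ (hf i) (hg j))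

⋆-comm : ∀ f g n → (f ⋆ g) n ≡ (g ⋆ f) n
⋆-comm f g n = trans (sym (binSum-flip (λ i j → f i * g j) n))
                     (binSum-cong (λ i j → *-comm (f j) (g i)) n)

⋆-distribʳ : ∀ f g h n → ((λ i → f i + g i) ⋆ h) n ≡ (f ⋆ h) n + (g ⋆ h) n
⋆-distribʳ f g h n =
  trans (binSum-cong (λ i j → *-distribʳ-+ (h j) (f i) (g i)) n)
        (binSum-+ (λ i j → f i * h j) (λ i j → g i * h j) n)

⋆-distribˡ : ∀ f g h n → (f ⋆ (λ i → g i + h i)) n ≡ (f ⋆ g) n + (f ⋆ h) n
⋆-distribˡ f g h n =
  trans (binSum-cong (λ i j → *-distribˡ-+ (f i) (g j) (h j)) n)
        (binSum-+ (λ i j → f i * g j) (λ i j → f i * h j) n)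

-- By the product rule, the derivative of either side is the sum of three triple products with one
-- factor differentiated, and the induction hypothesis matches these one by one.
⋆-assoc : ∀ f g h n → ((f ⋆ g) ⋆ h) n ≡ (f ⋆ (g ⋆ h)) n
⋆-assoc f g h zero = *-assoc (f 0) (g 0) (h 0)
⋆-assoc f g h (suc n) = begin
  ((λ i → (f′ ⋆ g) i + (f ⋆ g′) i) ⋆ h) n + ((f ⋆ g) ⋆ h′) n
    ≡⟨ cong (_+ ((f ⋆ g) ⋆ h′) n) (⋆-distribʳ (f′ ⋆ g) (f ⋆ g′) h n) ⟩
  (((f′ ⋆ g) ⋆ h) n + ((f ⋆ g′) ⋆ h) n) + ((f ⋆ g) ⋆ h′) n
    ≡⟨ cong₂ _+_ (cong₂ _+_ (⋆-assoc f′ g h n) (⋆-assoc f g′ h n)) (⋆-assoc f g h′ n) ⟩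
  ((f′ ⋆ (g ⋆ h)) n + (f ⋆ (g′ ⋆ h)) n) + (f ⋆ (g ⋆ h′)) n
    ≡⟨ +-assoc ((f′ ⋆ (g ⋆ h)) n) _ _ ⟩
  (f′ ⋆ (g ⋆ h)) n + ((f ⋆ (g′ ⋆ h)) n + (f ⋆ (g ⋆ h′)) n)
    ≡⟨ cong ((f′ ⋆ (g ⋆ h)) n +_) (⋆-distribˡ f (g′ ⋆ h) (g ⋆ h′) n) ⟨
  (f′ ⋆ (g ⋆ h)) n + (f ⋆ (λ i → (g′ ⋆ h) i + (g ⋆ h′) i)) n ∎
  where
  f′ = λ i → f (suc i)
  g′ = λ i → g (suc i)
  h′ = λ i → h (suc i)

δ₀ : ℕ → ℕ
δ₀ zero    = 1
δ₀ (suc _) = 0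

binSum-zero : ∀ {F} → (∀ i j → F i j ≡ 0) → ∀ n → binSum F n ≡ 0
binSum-zero h zero    = h 0 0
binSum-zero h (suc n) =
  cong₂ _+_ (binSum-zero (λ i j → h (suc i) j) n) (binSum-zero (λ i j → h i (suc j)) n)

⋆-identityˡ : ∀ f n → (δ₀ ⋆ f) n ≡ f n
⋆-identityˡ f zero = *-identityˡ (f 0)
⋆-identityˡ f (suc n) =
  trans (cong (_+ (δ₀ ⋆ (λ i → f (suc i))) n) (binSum-zero (λ _ _ → refl) n)) (⋆-identityˡ (λ i → f (suc i)) n)

VanishesOnOdds : (ℕ → ℕ) → Set
VanishesOnOdds f = ∀ n → f (suc (2 * n)) ≡ 0

antiSum-even : ∀ F → (∀ i j → F (suc (2 * i)) j ≡ 0) →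
  ∀ n → antiSum F (2 * n) ≡ antiSum (λ i j → F (2 * i) (2 * j)) n
antiSum-even F h zero = refl
antiSum-even F h (suc n) = begin
  antiSum F (2 * suc n)         ≡⟨ cong (antiSum F) (*-suc 2 n) ⟩
  F 0 (2 + 2 * n) + (F 1 (1 + 2 * n) + antiSum (λ i j → F (2 + i) j) (2 * n))
    ≡⟨ cong₂ (λ x y → F 0 x + (y + antiSum (λ i j → F (2 + i) j) (2 * n))) (sym (*-suc 2 n)) (h 0 (1 + 2 * n)) ⟩
  F 0 (2 * suc n) + antiSum (λ i j → F (2 + i) j) (2 * n)
    ≡⟨ cong (F 0 (2 * suc n) +_) (antiSum-even (λ i j → F (2 + i) j)
          (λ i j → trans (cong (λ m → F m j) (cong suc (sym (*-suc 2 i)))) (h (suc i) j)) n) ⟩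
  F 0 (2 * suc n) + antiSum (λ i j → F (2 + 2 * i) (2 * j)) n
    ≡⟨ cong (F 0 (2 * suc n) +_) (antiSum-cong n (λ i j _ → cong (λ m → F m (2 * j)) (sym (*-suc 2 i)))) ⟩
  F 0 (2 * suc n) + antiSum (λ i j → F (2 * suc i) (2 * j)) n ∎

antiSum-odd : ∀ F → (∀ i j → F (2 * i) j ≡ 0) →
  ∀ n → antiSum F (suc (2 * n)) ≡ antiSum (λ i j → F (suc (2 * i)) (2 * j)) n
antiSum-odd F h n =
  trans (cong (_+ antiSum (λ i j → F (suc i) j) (2 * n)) (h 0 (suc (2 * n))))
        (antiSum-even (λ i j → F (suc i) j)
          (λ i j → trans (cong (λ m → F m j) (sym (*-suc 2 i))) (h (suc i) j)) n)

antiSum-diagonal : ∀ F → (∀ i j → i ≢ j → F i j ≡ 0) → ∀ n → antiSum F (2 * n) ≡ F n n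
antiSum-diagonal F h zero = refl
antiSum-diagonal F h (suc n) = begin
  antiSum F (2 * suc n)         ≡⟨ cong (antiSum F) (*-suc 2 n) ⟩
  antiSum F (2 + 2 * n)         ≡⟨ antiSum-ends F (2 * n) ⟩
  F 0 (2 + 2 * n) + (antiSum (λ i j → F (suc i) (suc j)) (2 * n) + F (2 + 2 * n) 0)
    ≡⟨ cong₂ (λ x y → x + (antiSum (λ i j → F (suc i) (suc j)) (2 * n) + y)) (h 0 (2 + 2 * n) λ ()) (h (2 + 2 * n) 0 λ ()) ⟩
  antiSum (λ i j → F (suc i) (suc j)) (2 * n) + 0
    ≡⟨ +-identityʳ _ ⟩
  antiSum (λ i j → F (suc i) (suc j)) (2 * n)
    ≡⟨ antiSum-diagonal (λ i j → F (suc i) (suc j)) (λ i j ne → h (suc i) (suc j) (λ eq → ne (suc-injective eq))) n ⟩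
  F (suc n) (suc n) ∎

-- Counting closed walks

sumOver : {A : Set} → (A → ℕ) → List A → ℕ
sumOver f xs = sum (map f xs)

module _ {A : Set} where

  sumOver-cong : {f g : A → ℕ} → (∀ x → f x ≡ g x) → ∀ xs → sumOver f xs ≡ sumOver g xs
  sumOver-cong h xs = cong sum (map-cong h xs)

  sumOver-++ : ∀ (f : A → ℕ) xs ys → sumOver f (xs ++ ys) ≡ sumOver f xs + sumOver f ys
  sumOver-++ f xs ys = trans (cong sum (map-++ f xs ys)) (sum-++ (map f xs) (map f ys))

  sumOver-*ˡ : ∀ c (f : A → ℕ) xs → sumOver (λ x → c * f x) xs ≡ c * sumOver f xs
  sumOver-*ˡ c f []       = sym (*-zeroʳ c)
  sumOver-*ˡ c f (x ∷ xs) =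
    trans (cong ((c * f x) +_) (sumOver-*ˡ c f xs)) (sym (*-distribˡ-+ c (f x) _))

  sumOver-map : ∀ {B : Set} (f : A → ℕ) (g : B → A) xs → sumOver f (map g xs) ≡ sumOver (λ x → f (g x)) xs
  sumOver-map f g xs = cong sum (sym (map-∘ xs))

  sumOver-concatMap : ∀ {B : Set} (f : A → ℕ) (g : B → List A) xs →
    sumOver f (concatMap g xs) ≡ sumOver (λ x → sumOver f (g x)) xs
  sumOver-concatMap f g []       = refl
  sumOver-concatMap f g (x ∷ xs) =
    trans (sumOver-++ f (g x) (concatMap g xs)) (cong (_ +_) (sumOver-concatMap f g xs))

  sumOver-binSum : ∀ (F : A → ℕ → ℕ → ℕ) xs n →
    sumOver (λ x → binSum (F x) n) xs ≡ binSum (λ i j → sumOver (λ x → F x i j) xs) n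
  sumOver-binSum F []       n = sym (binSum-zero (λ _ _ → refl) n)
  sumOver-binSum F (x ∷ xs) n =
    trans (cong (binSum (F x) n +_) (sumOver-binSum F xs n))
          (sym (binSum-+ (F x) (λ i j → sumOver (λ y → F y i j) xs) n))

indicator : {P : Set} → Dec P → ℕ
indicator p = if does p then 1 else 0

length-filter : {A : Set} {P : A → Set} (P? : ∀ x → Dec (P x)) → ∀ xs →
  length (filter P? xs) ≡ sumOver (λ x → indicator (P? x)) xs
length-filter P? [] = refl
length-filter P? (x ∷ xs) with does (P? x)
... | true  = cong suc (length-filter P? xs)
... | false = length-filter P? xs

-- The endpoint carries an arbitrary weight because removing the first step translates the weight;
-- an induction on the indicator of the origin alone would not close.
walkSum : ∀ d → ℕ → (Vec ℤ d → ℕ) → ℕ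
walkSum d k p = sumOver (λ w → p (endpoint w)) (walks d k)

walkSum-cong : ∀ d k p q → (∀ v → p v ≡ q v) → walkSum d k p ≡ walkSum d k q
walkSum-cong d k p q h = sumOver-cong (λ w → h (endpoint w)) (walks d k)

walkSum-suc : ∀ d k p →
  walkSum d (suc k) p ≡ sumOver (λ s → walkSum d k (λ v → p (zipWith _+ℤ_ (stepVec s) v))) (allSteps d)
walkSum-suc d k p =
  trans (sumOver-concatMap (λ w → p (endpoint w)) (λ s → map (s ∷_) (walks d k)) (allSteps d))
        (sumOver-cong (λ s → sumOver-map (λ w → p (endpoint w)) (s ∷_) (walks d k)) (allSteps d))

sumOver-signed : {A : Set} (h : A × Bool → ℕ) → ∀ xs →
  sumOver h (cartesianProduct xs (true ∷ false ∷ [])) ≡ sumOver (λ i → h (i , true) + h (i , false)) xs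
sumOver-signed h []       = refl
sumOver-signed h (x ∷ xs) =
  trans (cong (λ t → h (x , true) + (h (x , false) + t)) (sumOver-signed h xs))
        (sym (+-assoc (h (x , true)) _ _))

sumOver-allSteps-suc : ∀ d (h : Step (suc d) → ℕ) →
  sumOver h (allSteps (suc d)) ≡
  (h (zero , true) + h (zero , false)) + sumOver (λ s → h (suc (proj₁ s) , proj₂ s)) (allSteps d)
sumOver-allSteps-suc d h = begin
  sumOver h (allSteps (suc d))
    ≡⟨ sumOver-signed h (allFin (suc d)) ⟩
  (h (zero , true) + h (zero , false)) + sumOver (λ i → h (i , true) + h (i , false)) (Data.List.tabulate suc)
    ≡⟨ cong (λ xs → (h (zero , true) + h (zero , false)) + sumOver (λ i → h (i , true) + h (i , false)) xs)
         (sym (map-tabulate (λ i → i) suc)) ⟩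
  _ ≡⟨ cong ((h (zero , true) + h (zero , false)) +_) (sumOver-map (λ i → h (i , true) + h (i , false)) suc (allFin d)) ⟩
  _ ≡⟨ cong ((h (zero , true) + h (zero , false)) +_) (sumOver-signed (λ s → h (suc (proj₁ s) , proj₂ s)) (allFin d)) ⟨
  (h (zero , true) + h (zero , false)) + sumOver (λ s → h (suc (proj₁ s) , proj₂ s)) (allSteps d) ∎

_⊗_ : ∀ {d} → (ℤ → ℕ) → (Vec ℤ d → ℕ) → Vec ℤ (suc d) → ℕ
(p ⊗ q) (x ∷ v) = p x * q v

-- The total weight of the walks on the line: i steps up and j steps down end at `i ⊖ j`, and
-- `binSum` accounts for their orders.
lineSum : ℕ → (ℤ → ℕ) → ℕ
lineSum n p = binSum (λ i j → p (i ⊖ j)) n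

lineSum-suc : ∀ n p → lineSum (suc n) p ≡ lineSum n (λ x → p (pos 1 +ℤ x)) + lineSum n (λ x → p (-[1+ 0 ] +ℤ x))
lineSum-suc n p = cong₂ _+_
  (binSum-cong (λ i j → cong p (sym (distribʳ-⊖-+-pos 1 i j))) n)
  (binSum-cong (λ i j → cong p (sym (distribʳ-⊖-+-neg 0 i j))) n)

zipWith-zeros : ∀ {d} (v : Vec ℤ d) → zipWith _+ℤ_ (tabulate (λ _ → pos 0)) v ≡ v
zipWith-zeros []      = refl
zipWith-zeros (x ∷ v) = cong₂ _∷_ (+ℤ-identityˡ x) (zipWith-zeros v)

-- The first step either runs along the new axis or belongs to the other d axes. These are the two
-- summands in the successor clause of `binSum`, so the shuffles are counted by the recursion
-- itself.
walkSum-⊗ : ∀ d k p q →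
  walkSum (suc d) k (p ⊗ q) ≡ binSum (λ i j → lineSum i p * walkSum d j q) k
walkSum-⊗ d zero p q = go (p (pos 0)) (q (origin d))
  where
  go : ∀ x y → x * y + 0 ≡ x * (y + 0)
  go = solve-∀
walkSum-⊗ d (suc k) p q = begin
  walkSum (suc d) (suc k) (p ⊗ q)
    ≡⟨ walkSum-suc (suc d) k (p ⊗ q) ⟩
  sumOver shifted (allSteps (suc d))
    ≡⟨ sumOver-allSteps-suc d shifted ⟩
  (shifted (zero , true) + shifted (zero , false)) + sumOver (λ s → shifted (suc (proj₁ s) , proj₂ s)) (allSteps d)
    ≡⟨ cong₂ _+_ (cong₂ _+_ (axis true) (axis false)) (sumOver-cong other (allSteps d)) ⟩
  (binSum (λ i j → lineSum i p⁺ * walkSum d j q) k + binSum (λ i j → lineSum i p⁻ * walkSum d j q) k)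
    + sumOver (λ s → binSum (λ i j → lineSum i p * walkSum d j (λ v → q (zipWith _+ℤ_ (stepVec s) v))) k) (allSteps d)
    ≡⟨ cong₂ _+_ (sym (binSum-+ (λ i j → lineSum i p⁺ * walkSum d j q) (λ i j → lineSum i p⁻ * walkSum d j q) k))
                 (sumOver-binSum (λ s i j → lineSum i p * walkSum d j (λ v → q (zipWith _+ℤ_ (stepVec s) v))) (allSteps d) k) ⟩
  binSum (λ i j → lineSum i p⁺ * walkSum d j q + lineSum i p⁻ * walkSum d j q) k
    + binSum (λ i j → sumOver (λ s → lineSum i p * walkSum d j (λ v → q (zipWith _+ℤ_ (stepVec s) v))) (allSteps d)) k
    ≡⟨ cong₂ _+_
         (binSum-cong (λ i j → trans (sym (*-distribʳ-+ (walkSum d j q) (lineSum i p⁺) (lineSum i p⁻)))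
                                     (cong (_* walkSum d j q) (sym (lineSum-suc i p)))) k)
         (binSum-cong (λ i j → trans (sumOver-*ˡ (lineSum i p) _ (allSteps d))
                                     (cong (lineSum i p *_) (sym (walkSum-suc d j q)))) k) ⟩
  binSum (λ i j → lineSum (suc i) p * walkSum d j q) k + binSum (λ i j → lineSum i p * walkSum d (suc j) q) k ∎
  where
  p⁺ p⁻ : ℤ → ℕ
  p⁺ x = p (pos 1 +ℤ x)
  p⁻ x = p (-[1+ 0 ] +ℤ x)
  shifted : Step (suc d) → ℕ
  shifted s = walkSum (suc d) k (λ v → (p ⊗ q) (zipWith _+ℤ_ (stepVec s) v))
  axis : ∀ b → shifted (zero , b) ≡ binSum (λ i j → lineSum i (λ x → p ((if b then pos 1 else -[1+ 0 ]) +ℤ x)) * walkSum d j q) k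
  axis b = trans
    (walkSum-cong (suc d) k (λ v → (p ⊗ q) (zipWith _+ℤ_ (stepVec (zero , b)) v)) ((λ x → p ((if b then pos 1 else -[1+ 0 ]) +ℤ x)) ⊗ q) λ { (x ∷ v) → cong (λ u → p ((if b then pos 1 else -[1+ 0 ]) +ℤ x) * q u) (zipWith-zeros v) })
    (walkSum-⊗ d k (λ x → p ((if b then pos 1 else -[1+ 0 ]) +ℤ x)) q)
  other : ∀ s → shifted (suc (proj₁ s) , proj₂ s) ≡
    binSum (λ i j → lineSum i p * walkSum d j (λ v → q (zipWith _+ℤ_ (stepVec s) v))) k
  other s = trans
    (walkSum-cong (suc d) k (λ v → (p ⊗ q) (zipWith _+ℤ_ (stepVec (suc (proj₁ s) , proj₂ s)) v)) (p ⊗ (λ v → q (zipWith _+ℤ_ (stepVec s) v))) λ { (x ∷ v) → cong (λ y → p y * q (zipWith _+ℤ_ (stepVec s) v)) (+ℤ-identityˡ x) })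
    (walkSum-⊗ d k p (λ v → q (zipWith _+ℤ_ (stepVec s) v)))

atOrigin : ∀ d → Vec ℤ d → ℕ
atOrigin d v = indicator (≡-dec _≟ℤ_ v (origin d))

closedWalks : ℕ → ℕ → ℕ
closedWalks d m = walkSum d m (atOrigin d)

W≡closedWalks : ∀ d n → W d n ≡ closedWalks d (2 * n)
W≡closedWalks d n = length-filter (λ w → ≡-dec _≟ℤ_ (endpoint w) (origin d)) (walks d (2 * n))

closedLineWalks : ℕ → ℕ
closedLineWalks n = lineSum n (λ x → indicator (x ≟ℤ pos 0))

closedWalks-zero : ∀ m → closedWalks 0 m ≡ δ₀ m
closedWalks-zero zero    = refl
closedWalks-zero (suc m) = refl

closedWalks-suc : ∀ d m → closedWalks (suc d) m ≡ (closedLineWalks ⋆ closedWalks d) m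
closedWalks-suc d m = trans
  (walkSum-cong (suc d) m (atOrigin (suc d)) ((λ x → indicator (x ≟ℤ pos 0)) ⊗ atOrigin d) λ { (x ∷ v) → if-∧ (does (x ≟ℤ pos 0)) (does (≡-dec _≟ℤ_ v (origin d))) })
  (walkSum-⊗ d m (λ x → indicator (x ≟ℤ pos 0)) (atOrigin d))
  where
  if-∧ : ∀ a b → (if a ∧ b then 1 else 0) ≡ (if a then 1 else 0) * (if b then 1 else 0)
  if-∧ true  b = sym (*-identityˡ _)
  if-∧ false b = refl

closedWalks-+ : ∀ a b m → closedWalks (a + b) m ≡ (closedWalks a ⋆ closedWalks b) m
closedWalks-+ zero b m = sym (trans (⋆-cong closedWalks-zero (λ _ → refl) m) (⋆-identityˡ (closedWalks b) m))
closedWalks-+ (suc a) b m = begin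
  closedWalks (suc (a + b)) m                            ≡⟨ closedWalks-suc (a + b) m ⟩
  (closedLineWalks ⋆ closedWalks (a + b)) m              ≡⟨ ⋆-cong {closedLineWalks} (λ _ → refl) (closedWalks-+ a b) m ⟩
  (closedLineWalks ⋆ (closedWalks a ⋆ closedWalks b)) m  ≡⟨ ⋆-assoc closedLineWalks (closedWalks a) (closedWalks b) m ⟨
  ((closedLineWalks ⋆ closedWalks a) ⋆ closedWalks b) m  ≡⟨ ⋆-cong (closedWalks-suc a) (λ _ → refl) m ⟨
  (closedWalks (suc a) ⋆ closedWalks b) m                ∎

closedWalks-one : ∀ m → closedWalks 1 m ≡ closedLineWalks m
closedWalks-one m = begin
  closedWalks 1 m                    ≡⟨ closedWalks-suc 0 m ⟩
  (closedLineWalks ⋆ closedWalks 0) m ≡⟨ ⋆-cong {closedLineWalks} (λ _ → refl) closedWalks-zero m ⟩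
  (closedLineWalks ⋆ δ₀) m            ≡⟨ ⋆-comm closedLineWalks δ₀ m ⟩
  (δ₀ ⋆ closedLineWalks) m            ≡⟨ ⋆-identityˡ closedLineWalks m ⟩
  closedLineWalks m                  ∎

indicator-⊖-≢ : ∀ {i j} → i ≢ j → indicator ((i ⊖ j) ≟ℤ pos 0) ≡ 0
indicator-⊖-≢ {i} {j} i≢j with (i ⊖ j) ≟ℤ pos 0
... | yes eq = ⊥-elim (i≢j (+ℤ-injective (i-j≡0⇒i≡j (pos i) (pos j) (trans (m-n≡m⊖n i j) eq))))
... | no  _  = refl

closedLineWalks≡ : ∀ m → closedLineWalks m ≡ antiSum (λ i j → binom i j * indicator ((i ⊖ j) ≟ℤ pos 0)) m
closedLineWalks≡ = binSum≡antiSum (λ i j → indicator ((i ⊖ j) ≟ℤ pos 0))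

closedLineWalks-even : ∀ n → closedLineWalks (2 * n) ≡ binom n n
closedLineWalks-even n = begin
  closedLineWalks (2 * n)
    ≡⟨ closedLineWalks≡ (2 * n) ⟩
  antiSum (λ i j → binom i j * indicator ((i ⊖ j) ≟ℤ pos 0)) (2 * n)
    ≡⟨ antiSum-diagonal _ (λ i j i≢j → trans (cong (binom i j *_) (indicator-⊖-≢ i≢j)) (*-zeroʳ (binom i j))) n ⟩
  binom n n * indicator ((n ⊖ n) ≟ℤ pos 0)
    ≡⟨ cong (λ z → binom n n * indicator (z ≟ℤ pos 0)) (n⊖n≡0 n) ⟩
  binom n n * 1
    ≡⟨ *-identityʳ (binom n n) ⟩
  binom n n ∎

closedLineWalks-odd : VanishesOnOdds closedLineWalks
closedLineWalks-odd n = trans (closedLineWalks≡ (suc (2 * n))) (antiSum-zero (suc (2 * n)) λ i j i+j≡1+2n →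
  trans (cong (binom i j *_) (indicator-⊖-≢ λ i≡j → even≢odd i n
          (trans (cong (i +_) (trans (+-identityʳ i) i≡j)) i+j≡1+2n)))
        (*-zeroʳ (binom i j)))

evenOrOdd : ∀ n → (∃ λ k → n ≡ 2 * k) ⊎ (∃ λ k → n ≡ suc (2 * k))
evenOrOdd zero = inj₁ (0 , refl)
evenOrOdd (suc n) with evenOrOdd n
... | inj₁ (k , refl) = inj₂ (k , refl)
... | inj₂ (k , refl) = inj₁ (suc k , sym (*-suc 2 k))

⋆-vanishesOnOdds : ∀ f g → VanishesOnOdds f → VanishesOnOdds g → VanishesOnOdds (f ⋆ g)
⋆-vanishesOnOdds f g hf hg n = trans (binSum≡antiSum (λ i j → f i * g j) (suc (2 * n)))
  (antiSum-zero (suc (2 * n)) λ i j eq → trans (cong (binom i j *_) (term i j eq)) (*-zeroʳ (binom i j)))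
  where
  term : ∀ i j → i + j ≡ suc (2 * n) → f i * g j ≡ 0
  term i j eq with evenOrOdd i | evenOrOdd j
  ... | inj₂ (k , refl) | _ = cong (_* g j) (hf k)
  ... | inj₁ _ | inj₂ (l , refl) = trans (cong (f i *_) (hg l)) (*-zeroʳ (f i))
  ... | inj₁ (k , refl) | inj₁ (l , refl) = ⊥-elim (even≢odd (k + l) n (trans (*-distribˡ-+ 2 k l) eq))

closedWalks-odd : ∀ d → VanishesOnOdds (closedWalks d)
closedWalks-odd zero n = closedWalks-zero (suc (2 * n))
closedWalks-odd (suc d) n = trans (closedWalks-suc d (suc (2 * n)))
  (⋆-vanishesOnOdds closedLineWalks (closedWalks d) closedLineWalks-odd (closedWalks-odd d) n)

W-one : ∀ n → W 1 n ≡ binom n n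
W-one n = trans (W≡closedWalks 1 n) (trans (closedWalks-one (2 * n)) (closedLineWalks-even n))

W-+ : ∀ a b n → W (a + b) n ≡ antiSum (λ i j → binom (2 * i) (2 * j) * (W a i * W b j)) n
W-+ a b n = begin
  W (a + b) n                           ≡⟨ W≡closedWalks (a + b) n ⟩
  closedWalks (a + b) (2 * n)           ≡⟨ closedWalks-+ a b (2 * n) ⟩
  (closedWalks a ⋆ closedWalks b) (2 * n) ≡⟨ binSum≡antiSum _ (2 * n) ⟩
  antiSum (λ i j → binom i j * (closedWalks a i * closedWalks b j)) (2 * n)
    ≡⟨ antiSum-even _ (λ i j → trans (cong (λ x → binom (suc (2 * i)) j * (x * closedWalks b j)) (closedWalks-odd a i))
                                     (*-zeroʳ (binom (suc (2 * i)) j))) n ⟩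
  antiSum (λ i j → binom (2 * i) (2 * j) * (closedWalks a (2 * i) * closedWalks b (2 * j))) n
    ≡⟨ antiSum-cong n (λ i j _ → cong₂ (λ x y → binom (2 * i) (2 * j) * (x * y)) (sym (W≡closedWalks a i)) (sym (W≡closedWalks b j))) ⟩
  antiSum (λ i j → binom (2 * i) (2 * j) * (W a i * W b j)) n ∎

-- The product rule for a square, (f f)′ = 2 f′ f, exhibits the factor 2.
W-double : ∀ a n → W (a + a) (suc n) ≡
  2 * antiSum (λ i j → binom (suc (2 * i)) (2 * j) * (W a (suc i) * W a j)) n
W-double a n = begin
  W (a + a) (suc n)                       ≡⟨ W≡closedWalks (a + a) (suc n) ⟩
  closedWalks (a + a) (2 * suc n)         ≡⟨ closedWalks-+ a a (2 * suc n) ⟩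
  (A ⋆ A) (2 * suc n)                     ≡⟨ cong (A ⋆ A) (*-suc 2 n) ⟩
  (A′ ⋆ A) (suc (2 * n)) + (A ⋆ A′) (suc (2 * n))
    ≡⟨ cong ((A′ ⋆ A) (suc (2 * n)) +_) (trans (⋆-comm A A′ (suc (2 * n))) (sym (+-identityʳ _))) ⟩
  2 * (A′ ⋆ A) (suc (2 * n))
    ≡⟨ cong (2 *_) (binSum≡antiSum (λ i j → A′ i * A j) (suc (2 * n))) ⟩
  2 * antiSum (λ i j → binom i j * (A′ i * A j)) (suc (2 * n))
    ≡⟨ cong (2 *_) (antiSum-odd (λ i j → binom i j * (A′ i * A j)) (λ i j → trans (cong (λ x → binom (2 * i) j * (x * A j)) (closedWalks-odd a i))
                                                 (*-zeroʳ (binom (2 * i) j))) n) ⟩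
  2 * antiSum (λ i j → binom (suc (2 * i)) (2 * j) * (A (2 + 2 * i) * A (2 * j))) n
    ≡⟨ cong (2 *_) (antiSum-cong n λ i j _ → cong₂ (λ x y → binom (suc (2 * i)) (2 * j) * (x * y))
          (trans (cong A (sym (*-suc 2 i))) (sym (W≡closedWalks a (suc i)))) (sym (W≡closedWalks a j))) ⟩
  2 * antiSum (λ i j → binom (suc (2 * i)) (2 * j) * (W a (suc i) * W a j)) n ∎
  where
  A A′ : ℕ → ℕ
  A    = closedWalks a
  A′ i = A (suc i)

W-0 : ∀ d → W d 0 ≡ 1
W-0 zero    = refl
W-0 (suc d) = trans (W-+ 1 d 0) (cong₂ (λ x y → 1 * (x * y)) (W-one 0) (W-0 d))

-- The summand with i = 0 leaves all steps to the other axes, so positivity descends to dimension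
-- one.
W-positive : ∀ d n → 1 ≤ W (suc d) n
W-positive zero n = subst (1 ≤_) (sym (W-one n)) (binom-positive n n)
W-positive (suc d) n = subst (1 ≤_) (sym (W-+ 1 (suc d) n)) (≤-trans (W-positive d n)
  (≤-trans (≤-reflexive (sym eq)) (antiSum-head _ n)))
  where
  antiSum-head : ∀ F n → F 0 n ≤ antiSum F n
  antiSum-head F zero    = ≤-refl
  antiSum-head F (suc n) = m≤m+n (F 0 (suc n)) _
  eq : binom 0 (2 * n) * (W 1 0 * W (suc d) n) ≡ W (suc d) n
  eq = trans (*-identityˡ _) (trans (cong (_* W (suc d) n) (W-0 1)) (*-identityˡ _))

-- Parity, 2-adic valuation and binary digits

odd-+ : ∀ a b → odd (a + b) ≡ odd a xor odd b
odd-+ zero    b = refl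
odd-+ (suc a) b = trans (cong not (odd-+ a b)) (not-distribˡ-xor (odd a) (odd b))

odd-* : ∀ a b → odd (a * b) ≡ odd a ∧ odd b
odd-* zero    b = refl
odd-* (suc a) b rewrite odd-+ b (a * b) | odd-* a b = go (odd a) (odd b)
  where
  go : ∀ x y → y xor (x ∧ y) ≡ not x ∧ y
  go true  true  = refl
  go true  false = refl
  go false true  = refl
  go false false = refl

odd-double : ∀ n → odd (2 * n) ≡ false
odd-double n = odd-* 2 n

odd-suc-double : ∀ n → odd (suc (2 * n)) ≡ true
odd-suc-double n = cong not (odd-double n)

odd⇒suc-double : ∀ n → odd n ≡ true → ∃ λ k → n ≡ suc (2 * k)
odd⇒suc-double n h with evenOrOdd n
... | inj₂ r = r
... | inj₁ (k , refl) with () ← trans (sym (odd-double k)) h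

even⇒double : ∀ n → odd n ≡ false → ∃ λ k → n ≡ 2 * k
even⇒double n h with evenOrOdd n
... | inj₁ r = r
... | inj₂ (k , refl) with () ← trans (sym (odd-suc-double k)) h

infix 4 _≈_
_≈_ : ℕ → ℕ → Set
a ≈ b = odd a ≡ odd b

≈-+ : ∀ {a a′ b b′} → a ≈ a′ → b ≈ b′ → a + b ≈ a′ + b′
≈-+ {a} {a′} {b} {b′} p q = trans (odd-+ a b) (trans (cong₂ _xor_ p q) (sym (odd-+ a′ b′)))

≈-* : ∀ {a a′ b b′} → a ≈ a′ → b ≈ b′ → a * b ≈ a′ * b′
≈-* {a} {a′} {b} {b′} p q = trans (odd-* a b) (trans (cong₂ _∧_ p q) (sym (odd-* a′ b′)))

x+x≈0 : ∀ x → x + x ≈ 0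
x+x≈0 x = trans (odd-+ x x) (xor-same (odd x))

x*x≈x : ∀ x → x * x ≈ x
x*x≈x x = trans (odd-* x x) (∧-idem (odd x))

⌊2*n/2⌋ : ∀ n → ⌊ 2 * n /2⌋ ≡ n
⌊2*n/2⌋ n = trans (cong (λ m → ⌊ n + m /2⌋) (+-identityʳ n)) (sym (n≡⌊n+n/2⌋ n))

⌊suc[2*n]/2⌋ : ∀ n → ⌊ suc (2 * n) /2⌋ ≡ n
⌊suc[2*n]/2⌋ n = trans (cong (λ m → ⌊ suc (n + m) /2⌋) (+-identityʳ n)) (go n)
  where
  go : ∀ n → ⌊ suc (n + n) /2⌋ ≡ n
  go zero = refl
  go (suc n) rewrite +-suc n n = cong suc (go n)

ν₂-go-odd : ∀ f n → odd n ≡ true → n ≤ f → ν₂-go f n ≡ 0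
ν₂-go-odd (suc f) (suc n) h _ rewrite h = refl
ν₂-go-odd zero    (suc n) h ()

ν₂-go-double : ∀ f n → ν₂-go (suc f) (2 * suc n) ≡ suc (ν₂-go f (suc n))
ν₂-go-double f n = begin
  ν₂-go (suc f) (2 * suc n)
    ≡⟨⟩
  (if odd (2 * suc n) then 0 else suc (ν₂-go f ⌊ 2 * suc n /2⌋))
    ≡⟨ cong₂ (λ b m → if b then 0 else suc (ν₂-go f m)) (odd-double (suc n)) (⌊2*n/2⌋ (suc n)) ⟩
  suc (ν₂-go f (suc n)) ∎

odd⇒positive : ∀ n → odd n ≡ true → 1 ≤ n
odd⇒positive (suc n) _ = s≤s z≤n

2^-positive : ∀ v → 1 ≤ 2 ^ v
2^-positive v = m^n>0 2 v

ν₂-go-2^* : ∀ f v u → odd u ≡ true → 2 ^ v * u ≤ f → ν₂-go f (2 ^ v * u) ≡ v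
ν₂-go-2^* f zero u h le rewrite *-identityˡ u = ν₂-go-odd f u h le
ν₂-go-2^* f (suc v) u h le rewrite *-assoc 2 (2 ^ v) u
  with 2 ^ v * u in eq | *-mono-≤ (2^-positive v) (odd⇒positive u h)
... | suc m | _ with f
... | suc g = trans (ν₂-go-double g m) (cong suc (trans (cong (ν₂-go g) (sym eq)) (ν₂-go-2^* g v u h (≤-trans (≤-reflexive eq) bound))))
  where
  bound : suc m ≤ g
  bound = s≤s⁻¹ (≤-trans (s≤s (≤-trans (m≤m+n (suc m) 0) (m≤n+m (suc m + 0) m))) le)

-- Together with `ν₂-decompose` this characterises the valuation of positive numbers without
-- reference to fuel.
ν₂-2^* : ∀ v u → odd u ≡ true → ν₂ (2 ^ v * u) ≡ v
ν₂-2^* v u h = ν₂-go-2^* _ v u h ≤-refl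

private
  2^*odd-below : ∀ f n → n ≤ f → 1 ≤ n → ∃ λ v → ∃ λ u → odd u ≡ true × n ≡ 2 ^ v * u
  2^*odd-below zero    n n≤0 1≤n with () ← ≤-trans 1≤n n≤0
  2^*odd-below (suc f) n n≤f 1≤n with evenOrOdd n
  ... | inj₂ (k , refl) = 0 , suc (2 * k) , odd-suc-double k , sym (*-identityˡ _)
  ... | inj₁ (zero , refl) with () ← 1≤n
  2^*odd-below (suc f) n n≤f 1≤n | inj₁ (suc k , refl)
    with v , u , h , eq ← 2^*odd-below f (suc k) (s≤s⁻¹ (≤-trans (m<m+n (suc k) (s≤s z≤n)) n≤f)) (s≤s z≤n) =
    suc v , u , h , trans (cong (2 *_) eq) (sym (*-assoc 2 (2 ^ v) u))

ν₂-decompose : ∀ n → 1 ≤ n → ∃ λ u → odd u ≡ true × n ≡ 2 ^ ν₂ n * u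
ν₂-decompose n 1≤n with v , u , h , eq ← 2^*odd-below n n ≤-refl 1≤n =
  u , h , trans eq (cong (λ x → 2 ^ x * u) (sym (trans (cong ν₂ eq) (ν₂-2^* v u h))))

ν₂-* : ∀ m n → 1 ≤ m → 1 ≤ n → ν₂ (m * n) ≡ ν₂ m + ν₂ n
ν₂-* m n 1≤m 1≤n with u , hu , eqm ← ν₂-decompose m 1≤m | v , hv , eqn ← ν₂-decompose n 1≤n = begin
  ν₂ (m * n)                               ≡⟨ cong ν₂ (cong₂ _*_ eqm eqn) ⟩
  ν₂ ((2 ^ ν₂ m * u) * (2 ^ ν₂ n * v))     ≡⟨ cong ν₂ (shuffle (2 ^ ν₂ m) u (2 ^ ν₂ n) v) ⟩
  ν₂ ((2 ^ ν₂ m * 2 ^ ν₂ n) * (u * v))     ≡⟨ cong (λ x → ν₂ (x * (u * v))) (^-distribˡ-+-* 2 (ν₂ m) (ν₂ n)) ⟨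
  ν₂ (2 ^ (ν₂ m + ν₂ n) * (u * v))         ≡⟨ ν₂-2^* (ν₂ m + ν₂ n) (u * v) (trans (odd-* u v) (cong₂ _∧_ hu hv)) ⟩
  ν₂ m + ν₂ n                              ∎
  where
  shuffle : ∀ a b c d → (a * b) * (c * d) ≡ (a * c) * (b * d)
  shuffle = solve-∀

ν₂-odd : ∀ n → odd n ≡ true → ν₂ n ≡ 0
ν₂-odd n h = ν₂-go-odd n n h ≤-refl

ν₂-double : ∀ n → 1 ≤ n → ν₂ (2 * n) ≡ suc (ν₂ n)
ν₂-double n 1≤n = ν₂-* 2 n (s≤s z≤n) 1≤n

-- Binary digits and the theorems of Legendre and Kummer

bits : ℕ → List Bool
bits n = bitsLE-go n n

-- The recursive call inherits the fuel of the larger number, whereas `bits ⌊ n /2⌋` brings its own;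
-- `bits-suc` has to identify the two.
bitsLE-go-fuel : ∀ f g n → n ≤ f → n ≤ g → bitsLE-go f n ≡ bitsLE-go g n
bitsLE-go-fuel zero    zero    zero    _ _ = refl
bitsLE-go-fuel zero    (suc g) zero    _ _ = refl
bitsLE-go-fuel (suc f) zero    zero    _ _ = refl
bitsLE-go-fuel (suc f) (suc g) zero    _ _ = refl
bitsLE-go-fuel (suc f) (suc g) (suc n) (s≤s n≤f) (s≤s n≤g) =
  cong (odd (suc n) ∷_) (bitsLE-go-fuel f g ⌊ suc n /2⌋ (≤-trans le n≤f) (≤-trans le n≤g))
  where
  le : ⌊ suc n /2⌋ ≤ n
  le = s≤s⁻¹ (⌊n/2⌋<n n)

bits-suc : ∀ n → bits (suc n) ≡ odd (suc n) ∷ bits ⌊ suc n /2⌋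
bits-suc n = cong (odd (suc n) ∷_) (bitsLE-go-fuel n ⌊ suc n /2⌋ ⌊ suc n /2⌋ (s≤s⁻¹ (⌊n/2⌋<n n)) ≤-refl)

bits-double : ∀ n → bits (2 * suc n) ≡ false ∷ bits (suc n)
bits-double n = trans (bits-suc _)
  (cong₂ (λ b m → b ∷ bits m) (odd-double (suc n)) (⌊2*n/2⌋ (suc n)))

bits-suc-double : ∀ n → bits (suc (2 * n)) ≡ true ∷ bits n
bits-suc-double n = trans (bits-suc (2 * n))
  (cong₂ (λ b m → b ∷ bits m) (odd-suc-double n) (⌊suc[2*n]/2⌋ n))

ones : List Bool → ℕ
ones xs = length (filter (_≟B true) xs)

ones-reverse : ∀ xs → ones (reverse xs) ≡ ones xs
ones-reverse [] = refl
ones-reverse (x ∷ xs) = begin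
  ones (reverse (x ∷ xs))           ≡⟨ cong ones (unfold-reverse x xs) ⟩
  ones (reverse xs ++ (x ∷ []))     ≡⟨ ones-++ (reverse xs) (x ∷ []) ⟩
  ones (reverse xs) + ones (x ∷ []) ≡⟨ cong (_+ ones (x ∷ [])) (ones-reverse xs) ⟩
  ones xs + ones (x ∷ [])           ≡⟨ +-comm (ones xs) _ ⟩
  ones (x ∷ []) + ones xs           ≡⟨ ones-++ (x ∷ []) xs ⟨
  ones (x ∷ xs)                     ∎
  where
  ones-++ : ∀ xs ys → ones (xs ++ ys) ≡ ones xs + ones ys
  ones-++ xs ys = trans (cong length (filter-++ (_≟B true) xs ys)) (length-++ (filter (_≟B true) xs))

s₂≡ones : ∀ n → s₂ n ≡ ones (bits n)
s₂≡ones n = ones-reverse (bits n)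

s₂-double : ∀ n → s₂ (2 * n) ≡ s₂ n
s₂-double zero    = refl
s₂-double (suc n) = trans (s₂≡ones (2 * suc n)) (trans (cong ones (bits-double n)) (sym (s₂≡ones (suc n))))

s₂-suc-double : ∀ n → s₂ (suc (2 * n)) ≡ suc (s₂ n)
s₂-suc-double n = trans (s₂≡ones (suc (2 * n))) (trans (cong ones (bits-suc-double n)) (cong suc (sym (s₂≡ones n))))

-- Incrementing turns a trailing block 01…1 into 10…0.
ν₂+s₂-suc : ∀ n → ν₂ (suc n) + s₂ (suc n) ≡ suc (s₂ n)
ν₂+s₂-suc n = go n n ≤-refl
  where
  go : ∀ f n → n ≤ f → ν₂ (suc n) + s₂ (suc n) ≡ suc (s₂ n)
  go f n n≤f with evenOrOdd n
  go f n n≤f | inj₁ (k , refl) = cong₂ _+_ (ν₂-odd (suc (2 * k)) (odd-suc-double k))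
    (trans (s₂-suc-double k) (cong suc (sym (s₂-double k))))
  go (suc f) n n≤f | inj₂ (k , refl) = begin
    ν₂ (2 + 2 * k) + s₂ (2 + 2 * k)     ≡⟨ cong (λ m → ν₂ m + s₂ m) (*-suc 2 k) ⟨
    ν₂ (2 * suc k) + s₂ (2 * suc k)     ≡⟨ cong₂ _+_ (ν₂-double (suc k) (s≤s z≤n)) (s₂-double (suc k)) ⟩
    suc (ν₂ (suc k) + s₂ (suc k))       ≡⟨ cong suc (go f k (≤-trans (m≤m+n k (k + 0)) (s≤s⁻¹ n≤f))) ⟩
    suc (suc (s₂ k))                    ≡⟨ cong suc (s₂-suc-double k) ⟨
    suc (s₂ (suc (2 * k)))              ∎

-- Telescopes `ν₂+s₂-suc` over the factors of the factorial. The additive form avoids truncated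
-- subtraction, here and in `kummer`.
legendre : ∀ n → ν₂ (n !) + s₂ n ≡ n
legendre zero    = refl
legendre (suc n) = begin
  ν₂ (suc n !) + s₂ (suc n)                  ≡⟨ cong (_+ s₂ (suc n)) (ν₂-* (suc n) (n !) (s≤s z≤n) (1≤n! n)) ⟩
  ν₂ (suc n) + ν₂ (n !) + s₂ (suc n)         ≡⟨ shuffle (ν₂ (suc n)) (ν₂ (n !)) (s₂ (suc n)) ⟩
  ν₂ (n !) + (ν₂ (suc n) + s₂ (suc n))       ≡⟨ cong (ν₂ (n !) +_) (ν₂+s₂-suc n) ⟩
  ν₂ (n !) + suc (s₂ n)                      ≡⟨ +-suc (ν₂ (n !)) (s₂ n) ⟩
  suc (ν₂ (n !) + s₂ n)                      ≡⟨ cong suc (legendre n) ⟩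
  suc n                                      ∎
  where
  shuffle : ∀ a b c → a + b + c ≡ b + (a + c)
  shuffle = solve-∀

-- Legendre's formula for the three factorials in `binom-!`; the left side exceeds 0 carries exactly
-- when i and j share binary digits.
kummer : ∀ i j → ν₂ (binom i j) + s₂ (i + j) ≡ s₂ i + s₂ j
kummer i j = +-cancelˡ-≡ (ν₂ (i !) + ν₂ (j !)) _ _ (begin
  (ν₂ (i !) + ν₂ (j !)) + (ν₂ (binom i j) + s₂ (i + j))
    ≡⟨ shuffle₁ (ν₂ (i !)) (ν₂ (j !)) (ν₂ (binom i j)) (s₂ (i + j)) ⟩
  (ν₂ (binom i j) + (ν₂ (i !) + ν₂ (j !))) + s₂ (i + j)
    ≡⟨ cong (λ x → (ν₂ (binom i j) + x) + s₂ (i + j)) (ν₂-* (i !) (j !) (1≤n! i) (1≤n! j)) ⟨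
  (ν₂ (binom i j) + ν₂ (i ! * j !)) + s₂ (i + j)
    ≡⟨ cong (_+ s₂ (i + j)) (ν₂-* (binom i j) (i ! * j !) (binom-positive i j) (*-mono-≤ (1≤n! i) (1≤n! j))) ⟨
  ν₂ (binom i j * (i ! * j !)) + s₂ (i + j)
    ≡⟨ cong (λ x → ν₂ x + s₂ (i + j)) (binom-! i j) ⟩
  ν₂ ((i + j) !) + s₂ (i + j)
    ≡⟨ legendre (i + j) ⟩
  i + j
    ≡⟨ cong₂ _+_ (legendre i) (legendre j) ⟨
  (ν₂ (i !) + s₂ i) + (ν₂ (j !) + s₂ j)
    ≡⟨ shuffle₂ (ν₂ (i !)) (s₂ i) (ν₂ (j !)) (s₂ j) ⟩
  (ν₂ (i !) + ν₂ (j !)) + (s₂ i + s₂ j) ∎)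
  where
  shuffle₁ : ∀ a b c d → (a + b) + (c + d) ≡ (c + (a + b)) + d
  shuffle₁ = solve-∀
  shuffle₂ : ∀ a b c d → (a + b) + (c + d) ≡ (a + c) + (b + d)
  shuffle₂ = solve-∀

-- Walks in dimensions two and four

central : ℕ → ℕ
central n = binom n n

vandermonde : ∀ m k r → antiSum (λ i j → (m C i) * (k C j)) r ≡ ((m + k) C r)
vandermonde zero k zero    = refl
vandermonde zero k (suc r) =
  trans (cong₂ _+_ (*-identityˡ (k C suc r)) (antiSum-zero r (λ _ _ _ → refl)))
        (+-identityʳ _)
vandermonde (suc m) k zero    = refl
vandermonde (suc m) k (suc r) = begin
  1 * (k C suc r) + antiSum (λ i j → (suc m C suc i) * (k C j)) r
    ≡⟨ cong (1 * (k C suc r) +_) (antiSum-cong r λ i j _ →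
         trans (cong (_* (k C j)) (sym (nCk+nC[k+1]≡[n+1]C[k+1] m i))) (*-distribʳ-+ (k C j) (m C i) (m C suc i))) ⟩
  1 * (k C suc r) + antiSum (λ i j → (m C i) * (k C j) + (m C suc i) * (k C j)) r
    ≡⟨ cong (1 * (k C suc r) +_) (antiSum-+ (λ i j → (m C i) * (k C j)) (λ i j → (m C suc i) * (k C j)) r) ⟩
  1 * (k C suc r) + (antiSum (λ i j → (m C i) * (k C j)) r + antiSum (λ i j → (m C suc i) * (k C j)) r)
    ≡⟨ shuffle (1 * (k C suc r)) (antiSum (λ i j → (m C i) * (k C j)) r) _ ⟩
  antiSum (λ i j → (m C i) * (k C j)) r + antiSum (λ i j → (m C i) * (k C j)) (suc r)
    ≡⟨ cong₂ _+_ (vandermonde m k r) (vandermonde m k (suc r)) ⟩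
  ((m + k) C r) + ((m + k) C suc r)
    ≡⟨ nCk+nC[k+1]≡[n+1]C[k+1] (m + k) r ⟩
  (suc (m + k) C suc r) ∎
  where
  shuffle : ∀ a b c → a + (b + c) ≡ b + (a + c)
  shuffle = solve-∀

binom-square-sum : ∀ n → antiSum (λ i j → binom i j * binom i j) n ≡ central n
binom-square-sum n = trans
  (antiSum-cong n λ { i j refl → cong (binom i j *_) (trans (binom-comm i j) (cong (_C j) (+-comm j i))) })
  (vandermonde n n n)

*-cancelʳ-positive : ∀ {x y} c → 1 ≤ c → x * c ≡ y * c → x ≡ y
*-cancelʳ-positive {x} {y} c 1≤c = *-cancelʳ-≡ x y c {{>-nonZero 1≤c}}

central-! : ∀ n → central n * (n ! * n !) ≡ (2 * n) !
central-! n = trans (binom-! n n) (cong (λ m → (n + m) !) (sym (+-identityʳ n)))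

-- Pulls the factor `central n` out of a convolution: multiplied by the square of `i ! * j !`, both
-- sides become `(2 * (i + j)) !`.
binom-central : ∀ i j →
  binom (2 * i) (2 * j) * (central i * central j) ≡ central (i + j) * (binom i j * binom i j)
binom-central i j = *-cancelʳ-positive ((i ! * j !) * (i ! * j !))
  (*-mono-≤ (*-mono-≤ (1≤n! i) (1≤n! j)) (*-mono-≤ (1≤n! i) (1≤n! j))) (begin
  binom (2 * i) (2 * j) * (central i * central j) * ((i ! * j !) * (i ! * j !))
    ≡⟨ shuffle₁ (binom (2 * i) (2 * j)) (central i) (central j) (i !) (j !) ⟩
  binom (2 * i) (2 * j) * ((central i * (i ! * i !)) * (central j * (j ! * j !)))
    ≡⟨ cong₂ (λ x y → binom (2 * i) (2 * j) * (x * y)) (central-! i) (central-! j) ⟩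
  binom (2 * i) (2 * j) * ((2 * i) ! * (2 * j) !)
    ≡⟨ binom-! (2 * i) (2 * j) ⟩
  (2 * i + 2 * j) !
    ≡⟨ cong _! (*-distribˡ-+ 2 i j) ⟨
  (2 * (i + j)) !
    ≡⟨ central-! (i + j) ⟨
  central (i + j) * ((i + j) ! * (i + j) !)
    ≡⟨ cong (λ x → central (i + j) * (x * x)) (binom-! i j) ⟨
  central (i + j) * ((binom i j * (i ! * j !)) * (binom i j * (i ! * j !)))
    ≡⟨ shuffle₂ (central (i + j)) (binom i j) (i ! * j !) ⟩
  central (i + j) * (binom i j * binom i j) * ((i ! * j !) * (i ! * j !)) ∎)
  where
  shuffle₁ : ∀ b c d x y → b * (c * d) * ((x * y) * (x * y)) ≡ b * ((c * (x * x)) * (d * (y * y)))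
  shuffle₁ = solve-∀
  shuffle₂ : ∀ c b x → c * ((b * x) * (b * x)) ≡ c * (b * b) * (x * x)
  shuffle₂ = solve-∀

W-two : ∀ n → W 2 n ≡ central n * central n
W-two n = begin
  W 2 n
    ≡⟨ W-+ 1 1 n ⟩
  antiSum (λ i j → binom (2 * i) (2 * j) * (W 1 i * W 1 j)) n
    ≡⟨ antiSum-cong n (λ { i j refl → trans (cong₂ (λ x y → binom (2 * i) (2 * j) * (x * y)) (W-one i) (W-one j)) (binom-central i j) }) ⟩
  antiSum (λ i j → central n * (binom i j * binom i j)) n
    ≡⟨ antiSum-*ˡ (central n) (λ i j → binom i j * binom i j) n ⟩
  central n * antiSum (λ i j → binom i j * binom i j) n
    ≡⟨ cong (central n *_) (binom-square-sum n) ⟩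
  central n * central n ∎

-- The sums on the right are the Domb numbers 1, 4, 28, 256, ...
W-four-convolution : ∀ n →
  W 4 n ≡ central n * antiSum (λ i j → (binom i j * binom i j) * (central i * central j)) n
W-four-convolution n = begin
  W 4 n
    ≡⟨ W-+ 2 2 n ⟩
  antiSum (λ i j → binom (2 * i) (2 * j) * (W 2 i * W 2 j)) n
    ≡⟨ antiSum-cong n (λ { i j refl → term i j }) ⟩
  antiSum (λ i j → central n * ((binom i j * binom i j) * (central i * central j))) n
    ≡⟨ antiSum-*ˡ (central n) (λ i j → (binom i j * binom i j) * (central i * central j)) n ⟩
  central n * antiSum (λ i j → (binom i j * binom i j) * (central i * central j)) n ∎
  where
  shuffle : ∀ b c d → b * ((c * c) * (d * d)) ≡ (b * (c * d)) * (c * d)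
  shuffle = solve-∀
  term : ∀ i j → binom (2 * i) (2 * j) * (W 2 i * W 2 j) ≡
    central (i + j) * ((binom i j * binom i j) * (central i * central j))
  term i j = begin
    binom (2 * i) (2 * j) * (W 2 i * W 2 j)
      ≡⟨ cong₂ (λ x y → binom (2 * i) (2 * j) * (x * y)) (W-two i) (W-two j) ⟩
    binom (2 * i) (2 * j) * ((central i * central i) * (central j * central j))
      ≡⟨ shuffle (binom (2 * i) (2 * j)) (central i) (central j) ⟩
    (binom (2 * i) (2 * j) * (central i * central j)) * (central i * central j)
      ≡⟨ cong (_* (central i * central j)) (binom-central i j) ⟩
    (central (i + j) * (binom i j * binom i j)) * (central i * central j)
      ≡⟨ *-assoc (central (i + j)) _ _ ⟩
    central (i + j) * ((binom i j * binom i j) * (central i * central j)) ∎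

-- MacMahon's expansion and the Domb numbers

sumBelow : (ℕ → ℕ) → ℕ → ℕ
sumBelow f zero    = 0
sumBelow f (suc n) = f 0 + sumBelow (λ i → f (suc i)) n

sumBelow-cong : ∀ {f g} → (∀ i → f i ≡ g i) → ∀ n → sumBelow f n ≡ sumBelow g n
sumBelow-cong h zero    = refl
sumBelow-cong h (suc n) = cong₂ _+_ (h 0) (sumBelow-cong (λ i → h (suc i)) n)

sumBelow-zero : ∀ {f} → (∀ i → f i ≡ 0) → ∀ n → sumBelow f n ≡ 0
sumBelow-zero h zero    = refl
sumBelow-zero h (suc n) = cong₂ _+_ (h 0) (sumBelow-zero (λ i → h (suc i)) n)

sumBelow-+ : ∀ f g n → sumBelow (λ i → f i + g i) n ≡ sumBelow f n + sumBelow g n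
sumBelow-+ f g zero = refl
sumBelow-+ f g (suc n) rewrite sumBelow-+ (λ i → f (suc i)) (λ i → g (suc i)) n =
  swap (f 0) (g 0) (sumBelow (λ i → f (suc i)) n) _
  where
  swap : ∀ a b c d → (a + b) + (c + d) ≡ (a + c) + (b + d)
  swap = solve-∀

sumBelow-*ˡ : ∀ c f n → sumBelow (λ i → c * f i) n ≡ c * sumBelow f n
sumBelow-*ˡ c f zero    = sym (*-zeroʳ c)
sumBelow-*ˡ c f (suc n) =
  trans (cong (c * f 0 +_) (sumBelow-*ˡ c (λ i → f (suc i)) n)) (sym (*-distribˡ-+ c (f 0) _))

sumBelow-sucʳ : ∀ f n → sumBelow f (suc n) ≡ sumBelow f n + f n
sumBelow-sucʳ f zero    = +-identityʳ (f 0)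
sumBelow-sucʳ f (suc n) =
  trans (cong (f 0 +_) (sumBelow-sucʳ (λ i → f (suc i)) n)) (sym (+-assoc (f 0) _ _))

antiSum-sumBelow : ∀ (F : ℕ → ℕ → ℕ → ℕ) N n →
  antiSum (λ i j → sumBelow (λ k → F k i j) N) n ≡ sumBelow (λ k → antiSum (F k) n) N
antiSum-sumBelow F zero    n = antiSum-zero n (λ _ _ _ → refl)
antiSum-sumBelow F (suc N) n = trans
  (antiSum-+ (F 0) (λ i j → sumBelow (λ k → F (suc k) i j) N) n)
  (cong (antiSum (F 0) n +_) (antiSum-sumBelow (λ k → F (suc k)) N n))

-- Induction on x: after Pascal's rule the two sides differ by a telescoping sum.
binomial-product : ∀ x k l N → k < N →
  (x C k) * (x C l) ≡ sumBelow (λ j → ((k C j) * (l C j)) * ((x + j) C (k + l))) N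
binomial-product x zero l (suc N) _ = sym (begin
  (1 * 1) * ((x + 0) C l) + sumBelow (λ i → ((0 C suc i) * (l C suc i)) * ((x + suc i) C l)) N
    ≡⟨ cong₂ _+_ (cong (λ m → 1 * (m C l)) (+-identityʳ x))
         (sumBelow-zero (λ _ → refl) N) ⟩
  1 * (x C l) + 0
    ≡⟨ +-identityʳ _ ⟩
  1 * (x C l) ∎)
binomial-product x (suc k) zero (suc N) _ = sym (begin
  (1 * 1) * ((x + 0) C (suc k + 0)) + sumBelow (λ i → ((suc k C suc i) * (0 C suc i)) * ((x + suc i) C (suc k + 0))) N
    ≡⟨ cong₂ _+_ (cong₂ (λ m p → 1 * (m C p)) (+-identityʳ x) (+-identityʳ (suc k)))
         (sumBelow-zero (λ i → cong (_* ((x + suc i) C (suc k + 0))) (*-zeroʳ (suc k C suc i))) N) ⟩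
  1 * (x C suc k) + 0
    ≡⟨ trans (+-identityʳ _) (*-comm 1 (x C suc k)) ⟩
  (x C suc k) * 1 ∎)
binomial-product zero (suc k) (suc l) N _ =
  sym (sumBelow-zero vanish N)
  where
  vanish : ∀ j → ((suc k C j) * (suc l C j)) * (j C (suc k + suc l)) ≡ 0
  vanish j with j ≤? suc k
  ... | no  j≰k = cong (λ z → (z * (suc l C j)) * (j C (suc k + suc l))) (k>n⇒nCk≡0 (≰⇒> j≰k))
  ... | yes j≤k = trans (cong (((suc k C j) * (suc l C j)) *_)
                          (k>n⇒nCk≡0 (≤-trans (s≤s j≤k) (≤-trans (s≤s (m≤m+n (suc k) l)) (≤-reflexive (sym (+-suc (suc k) l)))))))
                        (*-zeroʳ ((suc k C j) * (suc l C j)))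
binomial-product (suc x) (suc k) (suc l) (suc N) (s≤s k<N) = begin
  (suc x C suc k) * (suc x C suc l)
    ≡⟨ cong₂ _*_ (sym (nCk+nC[k+1]≡[n+1]C[k+1] x k)) (sym (nCk+nC[k+1]≡[n+1]C[k+1] x l)) ⟩
  ((x C k) + (x C suc k)) * ((x C l) + (x C suc l))
    ≡⟨ expand (x C k) (x C suc k) (x C l) (x C suc l) ⟩
  (x C suc k) * (x C suc l) + ((x C k) * (x C suc l) + (x C suc k) * (x C l) + (x C k) * (x C l))
    -- The four instances must run up to the same limit in order to be added; hence the limit is any
    -- number above `k` instead of `suc k`.
    ≡⟨ cong₂ _+_ (binomial-product x (suc k) (suc l) (suc N) (s≤s k<N))
         (cong₂ _+_ (cong₂ _+_ (binomial-product x k (suc l) (suc N) k<1+N) (binomial-product x (suc k) l (suc N) (s≤s k<N)))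
                    (binomial-product x k l (suc N) k<1+N)) ⟩
  sumBelow P₀ (suc N) + (sumBelow P₁ (suc N) + sumBelow P₂ (suc N) + sumBelow P₃ (suc N))
    ≡⟨ cong (sumBelow P₀ (suc N) +_) (sym middle) ⟩
  sumBelow P₀ (suc N) + sumBelow Q (suc N)
    ≡⟨ sumBelow-+ P₀ Q (suc N) ⟨
  sumBelow (λ j → P₀ j + Q j) (suc N)
    ≡⟨ sumBelow-cong (λ j → trans (sym (*-distribˡ-+ ((suc k C j) * (suc l C j)) (((x + j) C (suc k + suc l))) (((x + j) C (k + suc l)))))
         (cong (((suc k C j) * (suc l C j)) *_) (trans (+-comm (((x + j) C (suc k + suc l))) _) (nCk+nC[k+1]≡[n+1]C[k+1] (x + j) (k + suc l))))) (suc N) ⟩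
  sumBelow (λ j → ((suc k C j) * (suc l C j)) * ((suc x + j) C (suc k + suc l))) (suc N) ∎
  where
  k<1+N : k < suc N
  k<1+N = m<n⇒m<1+n k<N
  P₀ P₁ P₂ P₃ Q T R : ℕ → ℕ
  P₀ j = ((suc k C j) * (suc l C j)) * ((x + j) C (suc k + suc l))
  P₁ j = ((k C j) * (suc l C j)) * ((x + j) C (k + suc l))
  P₂ j = ((suc k C j) * (l C j)) * ((x + j) C (suc k + l))
  P₃ j = ((k C j) * (l C j)) * ((x + j) C (k + l))
  Q j = ((suc k C j) * (suc l C j)) * ((x + j) C (k + suc l))
  -- The telescoping term: `Q j + T j` is `R j` plus the preceding value of `T`, read as 0 before
  -- `T 0`; and `T N` vanishes because `k < N`.
  T j = ((k C j) * (l C j)) * ((x + suc j) C suc (k + l))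
  R j = P₁ j + P₂ j + P₃ j
  expand : ∀ a b c d → (a + b) * (c + d) ≡ b * d + (a * d + b * c + a * c)
  expand = solve-∀
  T-split : ∀ j → T j ≡ ((k C j) * (l C j)) * (((x + j) C (k + l)) + ((x + j) C suc (k + l)))
  T-split j = cong (((k C j) * (l C j)) *_) (trans (cong (_C suc (k + l)) (+-suc x j))
                (sym (nCk+nC[k+1]≡[n+1]C[k+1] (x + j) (k + l))))
  head : ∀ X Y → 1 * X + 1 * (Y + X) ≡ 1 * X + 1 * X + 1 * Y
  head = solve-∀
  step : ∀ a a′ b b′ X Y →
    ((a′ + a) * (b′ + b)) * X + (a * b) * (Y + X) ≡
    ((a * (b′ + b)) * X + ((a′ + a) * b) * X + (a * b) * Y) + (a′ * b′) * X
  step = solve-∀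
  QT-zero : Q 0 + T 0 ≡ R 0
  QT-zero = begin
    Q 0 + T 0
      ≡⟨ cong₂ _+_ (cong (λ p → 1 * ((x + 0) C p)) (+-suc k l)) (T-split 0) ⟩
    1 * ((x + 0) C suc (k + l)) + 1 * (((x + 0) C (k + l)) + ((x + 0) C suc (k + l)))
      ≡⟨ head (((x + 0) C suc (k + l))) (((x + 0) C (k + l))) ⟩
    1 * ((x + 0) C suc (k + l)) + 1 * ((x + 0) C suc (k + l)) + 1 * ((x + 0) C (k + l))
      ≡⟨ cong (λ p → 1 * ((x + 0) C p) + 1 * ((x + 0) C suc (k + l)) + 1 * ((x + 0) C (k + l))) (+-suc k l) ⟨
    R 0 ∎
  QT-suc : ∀ i → Q (suc i) + T (suc i) ≡ R (suc i) + T i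
  QT-suc i
    rewrite T-split (suc i) | +-suc k l
          | sym (nCk+nC[k+1]≡[n+1]C[k+1] k i) | sym (nCk+nC[k+1]≡[n+1]C[k+1] l i) =
    step (k C suc i) (k C i) (l C suc i) (l C i) (((x + suc i) C suc (k + l))) (((x + suc i) C (k + l)))
  middle : sumBelow Q (suc N) ≡ sumBelow P₁ (suc N) + sumBelow P₂ (suc N) + sumBelow P₃ (suc N)
  middle = +-cancelʳ-≡ (sumBelow T N) _ _ (begin
    sumBelow Q (suc N) + sumBelow T N
      ≡⟨ cong (sumBelow Q (suc N) +_) (sym (trans (sumBelow-sucʳ T N)
           (trans (cong (λ z → sumBelow T N + (z * (l C N)) * ((x + suc N) C suc (k + l))) (k>n⇒nCk≡0 k<N)) (+-identityʳ _)))) ⟩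
    sumBelow Q (suc N) + sumBelow T (suc N)
      ≡⟨ sumBelow-+ Q T (suc N) ⟨
    (Q 0 + T 0) + sumBelow (λ i → Q (suc i) + T (suc i)) N
      ≡⟨ cong₂ _+_ QT-zero (sumBelow-cong QT-suc N) ⟩
    R 0 + sumBelow (λ i → R (suc i) + T i) N
      ≡⟨ cong (R 0 +_) (sumBelow-+ (λ i → R (suc i)) T N) ⟩
    R 0 + (sumBelow (λ i → R (suc i)) N + sumBelow T N)
      ≡⟨ +-assoc (R 0) _ _ ⟨
    sumBelow R (suc N) + sumBelow T N
      ≡⟨ cong (_+ sumBelow T N) (trans (sumBelow-+ (λ j → P₁ j + P₂ j) P₃ (suc N))
           (cong (_+ sumBelow P₃ (suc N)) (sumBelow-+ P₁ P₂ (suc N)))) ⟩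
    sumBelow P₁ (suc N) + sumBelow P₂ (suc N) + sumBelow P₃ (suc N) + sumBelow T N ∎)

-- The case `x = k + l` of `binomial-product`, where both factors on its left are `binom k l`. One
-- further factor `binom k l` gives the cubes in MacMahon's expansion.
binom-square-expansion : ∀ k l N → k < N →
  binom k l * binom k l ≡ sumBelow (λ j → ((k C j) * (l C j)) * binom (k + l) j) N
binom-square-expansion k l N k<N = begin
  binom k l * binom k l
    ≡⟨ cong (binom k l *_) (trans (binom-comm k l) (cong (_C l) (+-comm l k))) ⟩
  ((k + l) C k) * ((k + l) C l)
    ≡⟨ binomial-product (k + l) k l N k<N ⟩
  sumBelow (λ j → ((k C j) * (l C j)) * binom (k + l) j) N ∎

-- risingCentral k = (2k)! / k!
risingCentral : ℕ → ℕ
risingCentral k = central k * k !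

risingCentral-! : ∀ k → risingCentral k * k ! ≡ (2 * k) !
risingCentral-! k = trans (*-assoc (central k) (k !) (k !)) (central-! k)

risingCentral-suc : ∀ k → risingCentral (suc k) ≡ 2 * suc (2 * k) * risingCentral k
risingCentral-suc k = *-cancelʳ-positive (suc k !) (1≤n! (suc k)) (begin
  risingCentral (suc k) * suc k !
    ≡⟨ risingCentral-! (suc k) ⟩
  (2 * suc k) !
    ≡⟨ cong _! (*-suc 2 k) ⟩
  (2 + 2 * k) * ((1 + 2 * k) * (2 * k) !)
    ≡⟨ cong (λ x → (2 + 2 * k) * ((1 + 2 * k) * x)) (risingCentral-! k) ⟨
  (2 + 2 * k) * ((1 + 2 * k) * (risingCentral k * k !))
    ≡⟨ shuffle k (risingCentral k) (k !) ⟩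
  2 * suc (2 * k) * risingCentral k * (suc k * k !) ∎)
  where
  shuffle : ∀ k p f → (2 + 2 * k) * ((1 + 2 * k) * (p * f)) ≡ 2 * suc (2 * k) * p * (suc k * f)
  shuffle = solve-∀

-- Divided by (a+b)! (a+b+m)!, this is L((x+y)^m x^a y^b) = 4^m L(x^a y^b) for the functional
-- L(x^a y^b) = (2a)! (2b)! / (a! b! (a+b)!), the moments of (4 cos² φ, 4 sin² φ).
binSum-risingCentral : ∀ m a b →
  binSum (λ k l → risingCentral (a + k) * risingCentral (b + l)) m * (a + b) ! ≡
  4 ^ m * (m + (a + b)) ! * (risingCentral a * risingCentral b)
binSum-risingCentral zero a b
  rewrite +-identityʳ a | +-identityʳ b = shuffle (risingCentral a * risingCentral b) ((a + b) !)
  where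
  shuffle : ∀ x y → x * y ≡ 1 * y * x
  shuffle = solve-∀
binSum-risingCentral (suc m) a b = *-cancelʳ-positive (suc (a + b)) (s≤s z≤n) (begin
  (binSum (λ k l → R (a + suc k) * R (b + l)) m + binSum (λ k l → R (a + k) * R (b + suc l)) m) * (a + b) ! * suc (a + b)
    ≡⟨ cong₂ (λ x y → (x + y) * (a + b) ! * suc (a + b))
         (binSum-cong (λ k l → cong (λ z → R z * R (b + l)) (+-suc a k)) m)
         (binSum-cong (λ k l → cong (λ z → R (a + k) * R z) (+-suc b l)) m) ⟩
  (X + Y) * (a + b) ! * suc (a + b)
    ≡⟨ shuffle₁ X Y ((a + b) !) (suc (a + b)) ⟩
  X * (suc a + b) ! + Y * (suc (a + b)) !
    ≡⟨ cong (λ z → X * (suc a + b) ! + Y * z !) (+-suc a b) ⟨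
  X * (suc a + b) ! + Y * (a + suc b) !
    ≡⟨ cong₂ _+_ (binSum-risingCentral m (suc a) b) (binSum-risingCentral m a (suc b)) ⟩
  4 ^ m * (m + suc (a + b)) ! * (R (suc a) * R b) + 4 ^ m * (m + (a + suc b)) ! * (R a * R (suc b))
    ≡⟨ cong₂ (λ x y → 4 ^ m * (m + suc (a + b)) ! * (R (suc a) * R b) + 4 ^ m * x ! * (R a * y))
         (cong (m +_) (+-suc a b)) (risingCentral-suc b) ⟩
  4 ^ m * (m + suc (a + b)) ! * (R (suc a) * R b) + 4 ^ m * (m + suc (a + b)) ! * (R a * (2 * suc (2 * b) * R b))
    ≡⟨ cong₂ (λ x y → 4 ^ m * x ! * (y * R b) + 4 ^ m * x ! * (R a * (2 * suc (2 * b) * R b)))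
         (+-suc m (a + b)) (risingCentral-suc a) ⟩
  4 ^ m * Z * ((2 * suc (2 * a) * R a) * R b) + 4 ^ m * Z * (R a * (2 * suc (2 * b) * R b))
    -- The source of the powers of 4: the two recurrence factors satisfy 2(2a+1) + 2(2b+1) =
    -- 4(a+b+1).
    ≡⟨ shuffle₂ (4 ^ m) Z a b (R a) (R b) ⟩
  4 * 4 ^ m * Z * (R a * R b) * suc (a + b) ∎)
  where
  R = risingCentral
  X = binSum (λ k l → R (suc a + k) * R (b + l)) m
  Y = binSum (λ k l → R (a + k) * R (suc b + l)) m
  Z = (suc m + (a + b)) !
  shuffle₁ : ∀ x y f n → (x + y) * f * n ≡ x * (n * f) + y * (n * f)
  shuffle₁ = solve-∀
  shuffle₂ : ∀ q z a b r s →
    q * z * ((2 * suc (2 * a) * r) * s) + q * z * (r * (2 * suc (2 * b) * s)) ≡ 4 * q * z * (r * s) * suc (a + b)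
  shuffle₂ = solve-∀

binSum-risingCentral-diagonal : ∀ m j →
  binSum (λ k l → risingCentral (j + k) * risingCentral (j + l)) m ≡ 4 ^ m * central j * (2 * j + m) !
binSum-risingCentral-diagonal m j = *-cancelʳ-positive ((j + j) !) (1≤n! (j + j)) (begin
  binSum (λ k l → risingCentral (j + k) * risingCentral (j + l)) m * (j + j) !
    ≡⟨ binSum-risingCentral m j j ⟩
  4 ^ m * (m + (j + j)) ! * ((central j * j !) * (central j * j !))
    ≡⟨ shuffle (4 ^ m) ((m + (j + j)) !) (central j) (j !) ⟩
  4 ^ m * central j * (m + (j + j)) ! * (central j * (j ! * j !))
    ≡⟨ cong₂ (λ x y → 4 ^ m * central j * x ! * y)
         (trans (+-comm m (j + j)) (cong (λ z → j + z + m) (sym (+-identityʳ j)))) (binom-! j j) ⟩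
  4 ^ m * central j * (2 * j + m) ! * (j + j) ! ∎)
  where
  shuffle : ∀ q z c f → q * z * ((c * f) * (c * f)) ≡ q * c * z * (c * (f * f))
  shuffle = solve-∀

antiSum-shiftˡ : ∀ a F n → (∀ i j → i < a → F i j ≡ 0) → antiSum F (a + n) ≡ antiSum (λ i j → F (a + i) j) n
antiSum-shiftˡ zero    F n h = refl
antiSum-shiftˡ (suc a) F n h = trans
  (cong (_+ antiSum (λ i j → F (suc i) j) (a + n)) (h 0 (suc (a + n)) (s≤s z≤n)))
  (antiSum-shiftˡ a (λ i j → F (suc i) j) n (λ i j i<a → h (suc i) j (s≤s i<a)))

antiSum-shiftʳ : ∀ a F n → (∀ i j → j < a → F i j ≡ 0) → antiSum F (a + n) ≡ antiSum (λ i j → F i (a + j)) n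
antiSum-shiftʳ zero    F n h = refl
antiSum-shiftʳ (suc a) F n h = trans (antiSum-sucʳ F (a + n)) (trans
  (cong (antiSum (λ i j → F i (suc j)) (a + n) +_) (h (suc (a + n)) 0 (s≤s z≤n)))
  (trans (+-identityʳ _) (antiSum-shiftʳ a (λ i j → F i (suc j)) n (λ i j j<a → h i (suc j) (s≤s j<a)))))

-- Both sides are the multinomial coefficient with parts j, j, k, l. The parts are grouped as (j,k),
-- (j,l) on the left and as (j,j), (k,l) on the right.
multinomial : ∀ j k l →
  (binom j k * binom j l) * binom (j + k) (j + l) ≡ binom (2 * j) (k + l) * central j * binom k l
multinomial j k l = *-cancelʳ-positive ((j ! * k !) * (j ! * l !))
  (*-mono-≤ (*-mono-≤ (1≤n! j) (1≤n! k)) (*-mono-≤ (1≤n! j) (1≤n! l))) (begin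
  (binom j k * binom j l) * binom (j + k) (j + l) * ((j ! * k !) * (j ! * l !))
    ≡⟨ shuffle₁ (binom j k) (binom j l) (binom (j + k) (j + l)) (j !) (k !) (l !) ⟩
  binom (j + k) (j + l) * ((binom j k * (j ! * k !)) * (binom j l * (j ! * l !)))
    ≡⟨ cong₂ (λ x y → binom (j + k) (j + l) * (x * y)) (binom-! j k) (binom-! j l) ⟩
  binom (j + k) (j + l) * ((j + k) ! * (j + l) !)
    ≡⟨ binom-! (j + k) (j + l) ⟩
  (j + k + (j + l)) !
    ≡⟨ cong _! (regroup j k l) ⟩
  (2 * j + (k + l)) !
    ≡⟨ binom-! (2 * j) (k + l) ⟨
  binom (2 * j) (k + l) * ((2 * j) ! * (k + l) !)
    ≡⟨ cong₂ (λ x y → binom (2 * j) (k + l) * (x * y)) (central-! j) (binom-! k l) ⟨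
  binom (2 * j) (k + l) * ((central j * (j ! * j !)) * (binom k l * (k ! * l !)))
    ≡⟨ shuffle₂ (binom (2 * j) (k + l)) (central j) (binom k l) (j !) (k !) (l !) ⟩
  binom (2 * j) (k + l) * central j * binom k l * ((j ! * k !) * (j ! * l !)) ∎)
  where
  shuffle₁ : ∀ a b c x y z → (a * b) * c * ((x * y) * (x * z)) ≡ c * ((a * (x * y)) * (b * (x * z)))
  shuffle₁ = solve-∀
  shuffle₂ : ∀ a b c x y z → a * ((b * (x * x)) * (c * (y * z))) ≡ a * b * c * ((x * y) * (x * z))
  shuffle₂ = solve-∀
  regroup : ∀ j k l → j + k + (j + l) ≡ 2 * j + (k + l)
  regroup = solve-∀

-- For n = k + l this is n! times the value of L, the functional behind `binSum-risingCentral`, at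
-- C(k,j) C(l,j) b(k,l) x^k y^l, the part of b(k,l)³ x^k y^l that `binom-square-expansion`
-- multiplies by b(n,j).
dombWeight : ℕ → ℕ → ℕ → ℕ
dombWeight j k l = ((k C j) * (l C j)) * (binom k l * (risingCentral k * risingCentral l))

-- The first two factors give n! / (j! j! (n-2j)!), the coefficient of (xy)^j (x+y)^(n-2j) once
-- b(n,j) is set aside; the rest is the value of L at that polynomial. For 2j > n the binomial
-- coefficient is 0, so the truncated exponent does no harm.
dombTerm : ℕ → ℕ → ℕ
dombTerm n j = (n C (2 * j)) * (central j * (4 ^ (n ∸ 2 * j) * central j))

-- The factors C(k,j) and C(l,j) confine the sum to k, l ≥ j. After shifting both indices by j,
-- `multinomial` leaves `binom k l` as the only varying coefficient, so the polynomial is a multiple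
-- of (xy)^j (x+y)^m.
antiSum-dombWeight : ∀ n j → antiSum (dombWeight j) n ≡ dombTerm n j * n !
antiSum-dombWeight n j with 2 * j ≤? n
... | no 2j≰n = trans (antiSum-zero n vanish)
                  (cong (λ z → z * (central j * (4 ^ (n ∸ 2 * j) * central j)) * n !) (sym (k>n⇒nCk≡0 (≰⇒> 2j≰n))))
  where
  vanish : ∀ k l → k + l ≡ n → dombWeight j k l ≡ 0
  vanish k l k+l≡n with j ≤? k | j ≤? l
  ... | no j≰k | _ = cong (λ z → (z * (l C j)) * (binom k l * (risingCentral k * risingCentral l))) (k>n⇒nCk≡0 (≰⇒> j≰k))
  ... | yes _ | no j≰l = trans (cong (λ z → ((k C j) * z) * (binom k l * (risingCentral k * risingCentral l))) (k>n⇒nCk≡0 (≰⇒> j≰l)))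
                               (cong (_* (binom k l * (risingCentral k * risingCentral l))) (*-zeroʳ (k C j)))
  ... | yes j≤k | yes j≤l = ⊥-elim (2j≰n (≤-trans (+-mono-≤ j≤k (≤-trans (≤-reflexive (+-identityʳ j)) j≤l)) (≤-reflexive k+l≡n)))
... | yes 2j≤n with m , refl ← m≤n⇒∃[o]m+o≡n 2j≤n = begin
  antiSum (dombWeight j) (2 * j + m)
    ≡⟨ cong (antiSum (dombWeight j)) (regroup j m) ⟩
  antiSum (dombWeight j) (j + (j + m))
    ≡⟨ antiSum-shiftˡ j (dombWeight j) (j + m) (λ k l k<j →
         cong (λ z → (z * (l C j)) * (binom k l * (risingCentral k * risingCentral l))) (k>n⇒nCk≡0 k<j)) ⟩
  antiSum (λ k l → dombWeight j (j + k) l) (j + m)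
    ≡⟨ antiSum-shiftʳ j (λ k l → dombWeight j (j + k) l) m (λ k l l<j →
         trans (cong (λ z → (((j + k) C j) * z) * (binom (j + k) l * (risingCentral (j + k) * risingCentral l))) (k>n⇒nCk≡0 l<j))
               (cong (_* (binom (j + k) l * (risingCentral (j + k) * risingCentral l))) (*-zeroʳ ((j + k) C j)))) ⟩
  antiSum (λ k l → dombWeight j (j + k) (j + l)) m
    ≡⟨ antiSum-cong m (λ { k l refl → factor k l }) ⟩
  antiSum (λ k l → (B * central j) * (binom k l * (risingCentral (j + k) * risingCentral (j + l)))) m
    ≡⟨ antiSum-*ˡ (B * central j) (λ k l → binom k l * (risingCentral (j + k) * risingCentral (j + l))) m ⟩
  (B * central j) * antiSum (λ k l → binom k l * (risingCentral (j + k) * risingCentral (j + l))) m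
    ≡⟨ cong ((B * central j) *_) (binSum≡antiSum (λ k l → risingCentral (j + k) * risingCentral (j + l)) m) ⟨
  (B * central j) * binSum (λ k l → risingCentral (j + k) * risingCentral (j + l)) m
    ≡⟨ cong ((B * central j) *_) (binSum-risingCentral-diagonal m j) ⟩
  (B * central j) * (4 ^ m * central j * (2 * j + m) !)
    ≡⟨ shuffle₂ B (central j) (4 ^ m) ((2 * j + m) !) ⟩
  B * (central j * (4 ^ m * central j)) * (2 * j + m) !
    ≡⟨ cong (λ e → B * (central j * (4 ^ e * central j)) * (2 * j + m) !) (m+n∸m≡n (2 * j) m) ⟨
  dombTerm (2 * j + m) j * (2 * j + m) ! ∎
  where
  B = binom (2 * j) m
  regroup : ∀ j m → 2 * j + m ≡ j + (j + m)
  regroup = solve-∀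
  shuffle₁ : ∀ x b r → x * (b * r) ≡ (x * b) * r
  shuffle₁ = solve-∀
  shuffle₂ : ∀ b c q f → (b * c) * (q * c * f) ≡ b * (c * (q * c)) * f
  shuffle₂ = solve-∀
  factor : ∀ k l → dombWeight j (j + k) (j + l) ≡
    (binom (2 * j) (k + l) * central j) * (binom k l * (risingCentral (j + k) * risingCentral (j + l)))
  factor k l = begin
    (binom j k * binom j l) * (binom (j + k) (j + l) * r)    ≡⟨ shuffle₁ (binom j k * binom j l) (binom (j + k) (j + l)) r ⟩
    (binom j k * binom j l) * binom (j + k) (j + l) * r      ≡⟨ cong (_* r) (multinomial j k l) ⟩
    binom (2 * j) (k + l) * central j * binom k l * r        ≡⟨ *-assoc (binom (2 * j) (k + l) * central j) (binom k l) r ⟩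
    (binom (2 * j) (k + l) * central j) * (binom k l * r)    ∎
    where r = risingCentral (j + k) * risingCentral (j + l)

-- MacMahon's expansion under L: since L(x^k y^l) is `central k * central l` over `binom k l`, one
-- of the three factors `binom k l` cancels. Multiplication by `n !` clears the denominators of L.
domb-identity : ∀ n →
  antiSum (λ k l → (binom k l * binom k l) * (central k * central l)) n ≡
  sumBelow (λ j → binom n j * dombTerm n j) (suc n)
domb-identity n = *-cancelʳ-positive (n !) (1≤n! n) (begin
  antiSum (λ k l → (binom k l * binom k l) * (central k * central l)) n * n !
    ≡⟨ *-comm _ (n !) ⟩
  n ! * antiSum (λ k l → (binom k l * binom k l) * (central k * central l)) n
    ≡⟨ antiSum-*ˡ (n !) (λ k l → (binom k l * binom k l) * (central k * central l)) n ⟨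
  antiSum (λ k l → n ! * ((binom k l * binom k l) * (central k * central l))) n
    ≡⟨ antiSum-cong n (λ { k l refl → expand k l }) ⟩
  antiSum (λ k l → sumBelow (λ j → binom n j * dombWeight j k l) (suc n)) n
    ≡⟨ antiSum-sumBelow (λ j k l → binom n j * dombWeight j k l) (suc n) n ⟩
  sumBelow (λ j → antiSum (λ k l → binom n j * dombWeight j k l) n) (suc n)
    ≡⟨ sumBelow-cong (λ j → trans (antiSum-*ˡ (binom n j) (dombWeight j) n)
         (trans (cong (binom n j *_) (antiSum-dombWeight n j)) (shuffle (binom n j) (dombTerm n j) (n !)))) (suc n) ⟩
  sumBelow (λ j → n ! * (binom n j * dombTerm n j)) (suc n)
    ≡⟨ sumBelow-*ˡ (n !) (λ j → binom n j * dombTerm n j) (suc n) ⟩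
  n ! * sumBelow (λ j → binom n j * dombTerm n j) (suc n)
    ≡⟨ *-comm (n !) _ ⟩
  sumBelow (λ j → binom n j * dombTerm n j) (suc n) * n ! ∎)
  where
  shuffle : ∀ b t f → b * (t * f) ≡ f * (b * t)
  shuffle = solve-∀
  shuffle₁ : ∀ b x y c d → (b * (x * y)) * ((b * b) * (c * d)) ≡ (b * ((c * x) * (d * y))) * (b * b)
  shuffle₁ = solve-∀
  shuffle₂ : ∀ u c b → u * (c * b) ≡ b * (c * u)
  shuffle₂ = solve-∀
  expand : ∀ k l → (k + l) ! * ((binom k l * binom k l) * (central k * central l)) ≡
    sumBelow (λ j → binom (k + l) j * dombWeight j k l) (suc (k + l))
  expand k l = begin
    (k + l) ! * ((binom k l * binom k l) * (central k * central l))
      ≡⟨ cong (_* ((binom k l * binom k l) * (central k * central l))) (binom-! k l) ⟨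
    (binom k l * (k ! * l !)) * ((binom k l * binom k l) * (central k * central l))
      ≡⟨ shuffle₁ (binom k l) (k !) (l !) (central k) (central l) ⟩
    u * (binom k l * binom k l)
      ≡⟨ cong (u *_) (binom-square-expansion k l (suc (k + l)) (s≤s (m≤m+n k l))) ⟩
    u * sumBelow (λ j → ((k C j) * (l C j)) * binom (k + l) j) (suc (k + l))
      ≡⟨ sumBelow-*ˡ u (λ j → ((k C j) * (l C j)) * binom (k + l) j) (suc (k + l)) ⟨
    sumBelow (λ j → u * (((k C j) * (l C j)) * binom (k + l) j)) (suc (k + l))
      ≡⟨ sumBelow-cong (λ j → shuffle₂ u ((k C j) * (l C j)) (binom (k + l) j)) (suc (k + l)) ⟩
    sumBelow (λ j → binom (k + l) j * dombWeight j k l) (suc (k + l)) ∎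
    where u = binom k l * (risingCentral k * risingCentral l)

W-four : ∀ n → W 4 n ≡ sumBelow (λ j → central n * (binom n j * dombTerm n j)) (suc n)
W-four n = trans (W-four-convolution n) (trans (cong (central n *_) (domb-identity n))
  (sym (sumBelow-*ˡ (central n) (λ j → binom n j * dombTerm n j) (suc n))))

-- Residues modulo 2

≈-reflexive : ∀ {a b} → a ≡ b → a ≈ b
≈-reflexive = cong odd

antiSum-≈ : ∀ {F G} n → (∀ i j → i + j ≡ n → F i j ≈ G i j) → antiSum F n ≈ antiSum G n
antiSum-≈ zero h = h 0 0 refl
antiSum-≈ {F} {G} (suc n) h = ≈-+ {F 0 (suc n)} {G 0 (suc n)} (h 0 (suc n) refl)
  (antiSum-≈ {λ i j → F (suc i) j} {λ i j → G (suc i) j} n (λ i j eq → h (suc i) j (cong suc eq)))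

sumBelow-≈ : ∀ {f g} → (∀ i → f i ≈ g i) → ∀ n → sumBelow f n ≈ sumBelow g n
sumBelow-≈ h zero = refl
sumBelow-≈ {f} {g} h (suc n) = ≈-+ {f 0} {g 0} (h 0) (sumBelow-≈ {λ i → f (suc i)} {λ i → g (suc i)} (λ i → h (suc i)) n)

binSum-≈ : ∀ {F G} → (∀ i j → F i j ≈ G i j) → ∀ n → binSum F n ≈ binSum G n
binSum-≈ h zero = h 0 0
binSum-≈ {F} {G} h (suc n) = ≈-+ {binSum (λ i j → F (suc i) j) n} {binSum (λ i j → G (suc i) j) n}
  (binSum-≈ (λ i j → h (suc i) j) n) (binSum-≈ (λ i j → h i (suc j)) n)

⋆-≈ : ∀ {f f′ g g′} → (∀ i → f i ≈ f′ i) → (∀ j → g j ≈ g′ j) → ∀ n → (f ⋆ g) n ≈ (f′ ⋆ g′) n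
⋆-≈ {f} {f′} hf hg = binSum-≈ (λ i j → ≈-* {f i} {f′ i} (hf i) (hg j))

⋆-square≈δ₀ : ∀ f → f 0 ≈ 1 → ∀ n → (f ⋆ f) n ≈ δ₀ n
⋆-square≈δ₀ f h zero    = ≈-* {f 0} {1} {f 0} {1} h h
⋆-square≈δ₀ f h (suc n) = trans
  (≈-reflexive (cong (((λ i → f (suc i)) ⋆ f) n +_) (⋆-comm f (λ i → f (suc i)) n)))
  (x+x≈0 (((λ i → f (suc i)) ⋆ f) n))

-- Two applications of the product rule, (fg)″ = f″g + 2f′g′ + fg″, lose the middle term modulo 2,
-- so the second derivative again obeys the product rule.
binSum-even : ∀ F n → binSum F (2 * n) ≈ binSum (λ i j → F (2 * i) (2 * j)) n
binSum-even F zero = refl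
binSum-even F (suc n) = begin
  odd (binSum F (2 * suc n))
    ≡⟨ cong (λ m → odd (binSum F m)) (*-suc 2 n) ⟩
  odd ((A + B) + (B + D))
    ≡⟨ cong odd (shuffle A B D) ⟩
  odd ((A + D) + (B + B))
    ≡⟨ ≈-+ {A + D} {A + D} {B + B} {0} refl (x+x≈0 B) ⟩
  odd ((A + D) + 0)
    ≡⟨ cong odd (+-identityʳ (A + D)) ⟩
  odd (A + D)
    ≡⟨ ≈-+ {A} {A′} (binSum-even (λ i j → F (2 + i) j) n) (binSum-even (λ i j → F i (2 + j)) n) ⟩
  odd (A′ + D′)
    ≡⟨ cong odd (cong₂ _+_ (binSum-cong (λ i j → cong (λ m → F m (2 * j)) (sym (*-suc 2 i))) n)
                           (binSum-cong (λ i j → cong (λ m → F (2 * i) m) (sym (*-suc 2 j))) n)) ⟩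
  odd (binSum (λ i j → F (2 * i) (2 * j)) (suc n)) ∎
  where
  A  = binSum (λ i j → F (2 + i) j) (2 * n)
  B  = binSum (λ i j → F (1 + i) (1 + j)) (2 * n)
  D  = binSum (λ i j → F i (2 + j)) (2 * n)
  A′ = binSum (λ i j → F (2 + 2 * i) (2 * j)) n
  D′ = binSum (λ i j → F (2 * i) (2 + 2 * j)) n
  shuffle : ∀ a b d → (a + b) + (b + d) ≡ (a + d) + (b + b)
  shuffle = solve-∀

binSum-odd : ∀ F n → binSum F (suc (2 * n)) ≈
  binSum (λ i j → F (suc (2 * i)) (2 * j)) n + binSum (λ i j → F (2 * i) (suc (2 * j))) n
binSum-odd F n = ≈-+ {binSum (λ i j → F (suc i) j) (2 * n)} {binSum (λ i j → F (suc (2 * i)) (2 * j)) n}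
  (binSum-even (λ i j → F (suc i) j) n) (binSum-even (λ i j → F i (suc j)) n)

-- Lucas' theorem for the last digit. The four parity cases feed each other through Pascal's rule;
-- two last digits 1 collide, and there the two neighbours in Pascal's triangle are congruent and
-- cancel.
lucas-even-even : ∀ i j → binom (2 * i) (2 * j) ≈ binom i j
lucas-odd-even  : ∀ i j → binom (suc (2 * i)) (2 * j) ≈ binom i j
lucas-even-odd  : ∀ i j → binom (2 * i) (suc (2 * j)) ≈ binom i j
lucas-odd-odd   : ∀ i j → binom (suc (2 * i)) (suc (2 * j)) ≈ 0

lucas-even-even zero    j    = refl
lucas-even-even (suc i) zero = ≈-reflexive (trans (binom-zeroʳ (2 * suc i)) (sym (binom-zeroʳ (suc i))))
lucas-even-even (suc i) (suc j) = begin
  odd (binom (2 * suc i) (2 * suc j))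
    ≡⟨ cong odd (cong₂ binom (*-suc 2 i) (*-suc 2 j)) ⟩
  odd (binom (2 + 2 * i) (2 + 2 * j))
    ≡⟨ cong odd (binom-pascal (1 + 2 * i) (1 + 2 * j)) ⟩
  odd (binom (1 + 2 * i) (2 + 2 * j) + binom (2 + 2 * i) (1 + 2 * j))
    ≡⟨ cong odd (cong₂ (λ x y → binom (1 + 2 * i) x + binom y (1 + 2 * j)) (*-suc 2 j) (*-suc 2 i)) ⟨
  odd (binom (1 + 2 * i) (2 * suc j) + binom (2 * suc i) (1 + 2 * j))
    ≡⟨ ≈-+ {binom (1 + 2 * i) (2 * suc j)} {binom i (suc j)} (lucas-odd-even i (suc j)) (lucas-even-odd (suc i) j) ⟩
  odd (binom i (suc j) + binom (suc i) j)
    ≡⟨ cong odd (binom-pascal i j) ⟨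
  odd (binom (suc i) (suc j)) ∎

lucas-odd-even i zero = ≈-reflexive (trans (binom-zeroʳ (suc (2 * i))) (sym (binom-zeroʳ i)))
lucas-odd-even i (suc j) = begin
  odd (binom (suc (2 * i)) (2 * suc j))
    ≡⟨ cong (λ x → odd (binom (suc (2 * i)) x)) (*-suc 2 j) ⟩
  odd (binom (suc (2 * i)) (2 + 2 * j))
    ≡⟨ cong odd (binom-pascal (2 * i) (1 + 2 * j)) ⟩
  odd (binom (2 * i) (2 + 2 * j) + binom (suc (2 * i)) (1 + 2 * j))
    ≡⟨ cong (λ x → odd (binom (2 * i) x + binom (suc (2 * i)) (1 + 2 * j))) (*-suc 2 j) ⟨
  odd (binom (2 * i) (2 * suc j) + binom (suc (2 * i)) (1 + 2 * j))
    ≡⟨ ≈-+ {binom (2 * i) (2 * suc j)} {binom i (suc j)} {b′ = 0} (lucas-even-even i (suc j)) (lucas-odd-odd i j) ⟩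
  odd (binom i (suc j) + 0)
    ≡⟨ cong odd (+-identityʳ (binom i (suc j))) ⟩
  odd (binom i (suc j)) ∎

lucas-even-odd zero j = refl
lucas-even-odd (suc i) j = begin
  odd (binom (2 * suc i) (suc (2 * j)))
    ≡⟨ cong (λ x → odd (binom x (suc (2 * j)))) (*-suc 2 i) ⟩
  odd (binom (2 + 2 * i) (suc (2 * j)))
    ≡⟨ cong odd (binom-pascal (1 + 2 * i) (2 * j)) ⟩
  odd (binom (1 + 2 * i) (suc (2 * j)) + binom (2 + 2 * i) (2 * j))
    ≡⟨ cong (λ x → odd (binom (1 + 2 * i) (suc (2 * j)) + binom x (2 * j))) (*-suc 2 i) ⟨
  odd (binom (1 + 2 * i) (suc (2 * j)) + binom (2 * suc i) (2 * j))
    ≡⟨ ≈-+ {binom (1 + 2 * i) (suc (2 * j))} {0} {b′ = binom (suc i) j} (lucas-odd-odd i j) (lucas-even-even (suc i) j) ⟩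
  odd (binom (suc i) j) ∎

lucas-odd-odd i j = begin
  odd (binom (suc (2 * i)) (suc (2 * j)))
    ≡⟨ cong odd (binom-pascal (2 * i) (2 * j)) ⟩
  odd (binom (2 * i) (suc (2 * j)) + binom (suc (2 * i)) (2 * j))
    ≡⟨ ≈-+ {binom (2 * i) (suc (2 * j))} {binom i j} (lucas-even-odd i j) (lucas-odd-even i j) ⟩
  odd (binom i j + binom i j)
    ≡⟨ x+x≈0 (binom i j) ⟩
  false ∎

-- Powers of two split off, with the residues of the quotients

2^suc≈0 : ∀ v → 2 ^ suc v ≈ 0
2^suc≈0 v = odd-double (2 ^ v)

ν₂-even : ∀ n → 1 ≤ n → odd n ≡ false → ∃ λ v → ν₂ n ≡ suc v
ν₂-even n 1≤n h with even⇒double n h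
... | suc k , refl = ν₂ (suc k) , ν₂-double (suc k) (s≤s z≤n)
... | zero  , refl with () ← 1≤n

-- Either side is odd exactly when `ν₂ n` is 0. The positive multiplier `suc c` is what makes every
-- carry count.
2^ν₂≈ : ∀ c n → 1 ≤ n → 2 ^ (suc c * ν₂ n) ≈ n
2^ν₂≈ c n 1≤n with odd n in eq
... | true  = cong (λ v → odd (2 ^ v)) (trans (cong (suc c *_) (ν₂-odd n eq)) (*-zeroʳ (suc c)))
... | false with v , eqv ← ν₂-even n 1≤n eq =
  trans (cong (λ x → odd (2 ^ (suc c * x))) eqv) (2^suc≈0 (v + c * suc v))

2^-kummer : ∀ c i j → 2 ^ (c * s₂ i) * 2 ^ (c * s₂ j) ≡ 2 ^ (c * s₂ (i + j)) * 2 ^ (c * ν₂ (binom i j))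
2^-kummer c i j = begin
  2 ^ (c * s₂ i) * 2 ^ (c * s₂ j)                     ≡⟨ ^-distribˡ-+-* 2 (c * s₂ i) (c * s₂ j) ⟨
  2 ^ (c * s₂ i + c * s₂ j)                           ≡⟨ cong (2 ^_) (*-distribˡ-+ c (s₂ i) (s₂ j)) ⟨
  2 ^ (c * (s₂ i + s₂ j))                             ≡⟨ cong (λ x → 2 ^ (c * x)) (trans (sym (kummer i j)) (+-comm (ν₂ (binom i j)) _)) ⟩
  2 ^ (c * (s₂ (i + j) + ν₂ (binom i j)))             ≡⟨ cong (2 ^_) (*-distribˡ-+ c (s₂ (i + j)) (ν₂ (binom i j))) ⟩
  2 ^ (c * s₂ (i + j) + c * ν₂ (binom i j))           ≡⟨ ^-distribˡ-+-* 2 (c * s₂ (i + j)) (c * ν₂ (binom i j)) ⟩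
  2 ^ (c * s₂ (i + j)) * 2 ^ (c * ν₂ (binom i j))     ∎

-- Bound and equality case in one invariant: for positive `f n`, the valuation is at least
-- `c * s₂ n`, with equality exactly where `g n` is odd. Only the parity of `g` matters.
record Normal (c : ℕ) (f g : ℕ → ℕ) : Set where
  constructor normal
  field
    quotient : ℕ → ℕ
    factors  : ∀ n → f n ≡ 2 ^ (c * s₂ n) * quotient n
    residue  : ∀ n → quotient n ≈ g n

Normal-resp : ∀ {c f g g′} → (∀ n → g n ≈ g′ n) → Normal c f g → Normal c f g′
Normal-resp h (normal q eq par) = normal q eq λ n → trans (par n) (h n)

-- A carry in the addition i + j gains a factor 2, so modulo 2 only the carry-free pairs
-- survive, and these are the pairs for which binom i j is odd.
Normal-W-+ : ∀ {c a b f g} → Normal (suc c) (W a) f → Normal (suc c) (W b) g → Normal (suc c) (W (a + b)) (f ⋆ g)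
Normal-W-+ {c} {a} {b} {f} {g} (normal p p-eq p-par) (normal q q-eq q-par) = normal r r-eq r-par
  where
  quotient : ℕ → ℕ → ℕ
  quotient i j = (binom (2 * i) (2 * j) * 2 ^ (suc c * ν₂ (binom i j))) * (p i * q j)
  r : ℕ → ℕ
  r = antiSum quotient
  shuffle₁ : ∀ B x y u v → B * ((x * u) * (y * v)) ≡ (x * y) * (B * (u * v))
  shuffle₁ = solve-∀
  shuffle₂ : ∀ B x y w → (x * y) * (B * w) ≡ x * ((B * y) * w)
  shuffle₂ = solve-∀
  term : ∀ i j → binom (2 * i) (2 * j) * (W a i * W b j) ≡ 2 ^ (suc c * s₂ (i + j)) * quotient i j
  term i j = begin
    binom (2 * i) (2 * j) * (W a i * W b j)
      ≡⟨ cong₂ (λ x y → binom (2 * i) (2 * j) * (x * y)) (p-eq i) (q-eq j) ⟩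
    binom (2 * i) (2 * j) * ((2 ^ (suc c * s₂ i) * p i) * (2 ^ (suc c * s₂ j) * q j))
      ≡⟨ shuffle₁ (binom (2 * i) (2 * j)) (2 ^ (suc c * s₂ i)) (2 ^ (suc c * s₂ j)) (p i) (q j) ⟩
    (2 ^ (suc c * s₂ i) * 2 ^ (suc c * s₂ j)) * (binom (2 * i) (2 * j) * (p i * q j))
      ≡⟨ cong (_* (binom (2 * i) (2 * j) * (p i * q j))) (2^-kummer (suc c) i j) ⟩
    (2 ^ (suc c * s₂ (i + j)) * 2 ^ (suc c * ν₂ (binom i j))) * (binom (2 * i) (2 * j) * (p i * q j))
      ≡⟨ shuffle₂ (binom (2 * i) (2 * j)) (2 ^ (suc c * s₂ (i + j))) (2 ^ (suc c * ν₂ (binom i j))) (p i * q j) ⟩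
    2 ^ (suc c * s₂ (i + j)) * quotient i j ∎
  r-eq : ∀ n → W (a + b) n ≡ 2 ^ (suc c * s₂ n) * r n
  r-eq n = trans (W-+ a b n) (trans (antiSum-cong n (λ { i j refl → term i j }))
    (antiSum-*ˡ (2 ^ (suc c * s₂ n)) quotient n))
  r-par : ∀ n → r n ≈ (f ⋆ g) n
  r-par n = trans
    (antiSum-≈ {quotient} {λ i j → binom i j * (f i * g j)} n λ i j _ →
      -- Both factors are congruent to `binom i j`, the first by Lucas and the second as the carry
      -- factor; squaring changes nothing modulo 2, so just the weight of ⋆ remains.
      ≈-* {binom (2 * i) (2 * j) * 2 ^ (suc c * ν₂ (binom i j))} {binom i j}
        (trans (≈-* {binom (2 * i) (2 * j)} {binom i j} {b′ = binom i j} (lucas-even-even i j) (2^ν₂≈ c (binom i j) (binom-positive i j)))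
               (x*x≈x (binom i j)))
        (≈-* {p i} {f i} (p-par i) (q-par j)))
    (≈-reflexive (sym (binSum≡antiSum (λ i j → f i * g j) n)))

-- f ⋆ f ≈ δ₀ is the unit, so only the parity of the number of factors matters.
Normal-W-odd-* : ∀ {c a f} → f 0 ≈ 1 → Normal (suc c) (W a) f → ∀ k → Normal (suc c) (W (suc (2 * k) * a)) f
Normal-W-odd-* {c} {a} {f} h N zero = subst (λ d → Normal (suc c) (W d) f) (sym (+-identityʳ a)) N
Normal-W-odd-* {c} {a} {f} h N (suc k) = subst (λ d → Normal (suc c) (W d) f) (regroup a k)
  (Normal-resp cube (Normal-W-+ {b = suc (2 * k) * a} (Normal-W-+ {b = a} N N) (Normal-W-odd-* h N k)))
  where
  regroup : ∀ a k → a + a + suc (2 * k) * a ≡ suc (2 * suc k) * a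
  regroup = solve-∀
  cube : ∀ n → ((f ⋆ f) ⋆ f) n ≈ f n
  cube n = trans (⋆-≈ {f ⋆ f} {δ₀} {f} {f} (⋆-square≈δ₀ f h) (λ _ → refl) n) (≈-reflexive (⋆-identityˡ f n))

-- Residues in dimensions one, two and four

ν₂-central : ∀ n → ν₂ (central n) ≡ s₂ n
ν₂-central n = +-cancelʳ-≡ (s₂ (n + n)) _ _ (trans (kummer n n)
  (cong (s₂ n +_) (trans (sym (s₂-double n)) (cong (λ m → s₂ (n + m)) (+-identityʳ n)))))

private
  central-split : ∀ n → ∃ λ u → odd u ≡ true × central n ≡ 2 ^ s₂ n * u
  central-split n with u , h , eq ← ν₂-decompose (central n) (binom-positive n n) =
    u , h , trans eq (cong (λ v → 2 ^ v * u) (ν₂-central n))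

Normal-W-one : Normal 1 (W 1) (λ _ → 1)
Normal-W-one = normal (λ n → proj₁ (central-split n))
  (λ n → trans (W-one n) (trans (proj₂ (proj₂ (central-split n)))
             (cong (λ v → 2 ^ v * proj₁ (central-split n)) (sym (*-identityˡ (s₂ n))))))
  (λ n → proj₁ (proj₂ (central-split n)))

Normal-W-two : Normal 2 (W 2) (λ _ → 1)
Normal-W-two = normal (λ n → u n * u n) eq (λ n → ≈-* {u n} {1} {u n} {1} (h n) (h n))
  where
  u : ℕ → ℕ
  u n = proj₁ (central-split n)
  h : ∀ n → odd (u n) ≡ true
  h n = proj₁ (proj₂ (central-split n))
  shuffle : ∀ x u → (x * u) * (x * u) ≡ (x * x) * (u * u)
  shuffle = solve-∀
  eq : ∀ n → W 2 n ≡ 2 ^ (2 * s₂ n) * (u n * u n)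
  eq n = begin
    W 2 n                                   ≡⟨ W-two n ⟩
    central n * central n                   ≡⟨ cong (λ x → x * x) (proj₂ (proj₂ (central-split n))) ⟩
    (2 ^ s₂ n * u n) * (2 ^ s₂ n * u n)     ≡⟨ shuffle (2 ^ s₂ n) (u n) ⟩
    (2 ^ s₂ n * 2 ^ s₂ n) * (u n * u n)     ≡⟨ cong (_* (u n * u n)) (^-distribˡ-+-* 2 (s₂ n) (s₂ n)) ⟨
    2 ^ (s₂ n + s₂ n) * (u n * u n)         ≡⟨ cong (λ v → 2 ^ (s₂ n + v) * (u n * u n)) (sym (+-identityʳ (s₂ n))) ⟩
    2 ^ (2 * s₂ n) * (u n * u n)            ∎

-- The parity of e n detects the absence of adjacent 1s in n: by Kummer's theorem binom n ⌊ n /2⌋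
-- is odd iff n and its right shift have disjoint binary supports.
e : ℕ → ℕ
e n = binom n ⌊ n /2⌋

-- With `e-4k+1` and `e-4k+3` this covers the final digits 0, 01 and 11, the cases on which
-- `noAdjacentOnes` recurses.
e-double : ∀ n → e (2 * n) ≈ e n
e-double n with evenOrOdd n
... | inj₁ (k , refl) = trans (cong (λ m → odd (binom (2 * (2 * k)) m)) (⌊2*n/2⌋ (2 * k)))
  (trans (lucas-even-even (2 * k) k) (cong (λ m → odd (binom (2 * k) m)) (sym (⌊2*n/2⌋ k))))
... | inj₂ (k , refl) = trans (cong (λ m → odd (binom (2 * suc (2 * k)) m)) (⌊2*n/2⌋ (suc (2 * k))))
  (trans (lucas-even-odd (suc (2 * k)) k) (cong (λ m → odd (binom (suc (2 * k)) m)) (sym (⌊suc[2*n]/2⌋ k))))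

e-4k+1 : ∀ k → e (suc (2 * (2 * k))) ≈ e k
e-4k+1 k = trans (cong (λ m → odd (binom (suc (2 * (2 * k))) m)) (⌊suc[2*n]/2⌋ (2 * k)))
  (trans (lucas-odd-even (2 * k) k) (trans (cong (λ m → odd (binom (2 * k) m)) (sym (⌊2*n/2⌋ k))) (e-double k)))

e-4k+3 : ∀ k → e (suc (2 * suc (2 * k))) ≈ 0
e-4k+3 k = trans (cong (λ m → odd (binom (suc (2 * suc (2 * k))) m)) (⌊suc[2*n]/2⌋ (suc (2 * k))))
  (lucas-odd-odd (suc (2 * k)) k)

≈0-* : ∀ a b → a ≈ 0 → a * b ≈ 0
≈0-* a b h = trans (odd-* a b) (cong (_∧ odd b) h)

odd-2^ : ∀ v → 1 ≤ v → odd (2 ^ v) ≡ false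
odd-2^ (suc v) _ = 2^suc≈0 v

sumBelow-pick : ∀ h N x → h < N → sumBelow (λ j → if j ≡ᵇ h then x else 0) N ≡ x
sumBelow-pick zero    (suc N) x _         = trans (cong (x +_) (sumBelow-zero (λ _ → refl) N)) (+-identityʳ x)
sumBelow-pick (suc h) (suc N) x (s≤s h<N) = sumBelow-pick h N x h<N

*-odd≈ : ∀ x u → odd u ≡ true → x * u ≈ x
*-odd≈ x u h = trans (odd-* x u) (trans (cong (odd x ∧_) h) (∧-identityʳ (odd x)))

-- The summand has valuation 3 s₂ n + ν₂ (binom n j) + 3 ν₂ (binom (2j) m) + 2 ν₂ (m!) with m = n − 2j,
-- so it is minimal only for m ≤ 1, that is j = ⌊ n /2⌋.
W-four-summand : ∀ n j → ∃ λ r →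
  central n * (binom n j * dombTerm n j) ≡ 2 ^ (3 * s₂ n) * r ×
  r ≈ (if j ≡ᵇ ⌊ n /2⌋ then e n else 0)
W-four-summand n j with 2 * j ≤? n
... | no 2j≰n = 0
  , trans (cong (λ z → central n * (binom n j * (z * (central j * (4 ^ (n ∸ 2 * j) * central j))))) (k>n⇒nCk≡0 (≰⇒> 2j≰n)))
          (trans (trans (cong (central n *_) (*-zeroʳ (binom n j))) (*-zeroʳ (central n))) (sym (*-zeroʳ (2 ^ (3 * s₂ n)))))
  , cong (λ b → odd (if b then e n else 0)) (sym (dec-false (j ≟ ⌊ n /2⌋) j≢⌊n/2⌋))
  where
  j≢⌊n/2⌋ : j ≢ ⌊ n /2⌋
  j≢⌊n/2⌋ j≡ with evenOrOdd n
  ... | inj₁ (k , refl) = 2j≰n (≤-reflexive (cong (2 *_) (trans j≡ (⌊2*n/2⌋ k))))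
  ... | inj₂ (k , refl) = 2j≰n (≤-trans (≤-reflexive (cong (2 *_) (trans j≡ (⌊suc[2*n]/2⌋ k)))) (n≤1+n _))
... | yes 2j≤n with m , refl ← m≤n⇒∃[o]m+o≡n 2j≤n
  with ux , hx , eqx ← ν₂-decompose (central (2 * j + m)) (binom-positive (2 * j + m) (2 * j + m))
     | uy , hy , eqy ← ν₂-decompose (binom (2 * j + m) j) (binom-positive (2 * j + m) j)
     | uz , hz , eqz ← ν₂-decompose (binom (2 * j) m) (binom-positive (2 * j) m)
     | uc , hc , eqc ← ν₂-decompose (central j) (binom-positive j j) =
  2 ^ (A + X) * U , factorisation , trans (*-odd≈ (2 ^ (A + X)) U U-odd) (residue m refl)
  where
  N = 2 * j + m
  A = ν₂ (binom N j)
  B = ν₂ (binom (2 * j) m)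
  t = ν₂ (m !)
  X = 3 * B + 2 * t
  U = ux * (uy * (uz * (uc * uc)))
  U-odd : odd U ≡ true
  U-odd = trans (*-odd≈ ux (uy * (uz * (uc * uc)))
    (trans (*-odd≈ uy (uz * (uc * uc)) (trans (*-odd≈ uz (uc * uc) (trans (*-odd≈ uc uc hc) hc)) hz)) hy)) hx
  collect : ∀ X Y Z C P ux uy uz uc →
    (X * ux) * ((Y * uy) * ((Z * uz) * ((C * uc) * (P * (C * uc))))) ≡
    (X * (Y * (Z * (C * (P * C))))) * (ux * (uy * (uz * (uc * uc))))
  collect = solve-∀
  powers : ∀ a b c d p → 2 ^ a * (2 ^ b * (2 ^ c * (2 ^ d * (2 ^ p * 2 ^ d)))) ≡ 2 ^ (a + (b + (c + (d + (p + d)))))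
  powers a b c d p
    rewrite ^-distribˡ-+-* 2 a (b + (c + (d + (p + d)))) | ^-distribˡ-+-* 2 b (c + (d + (p + d)))
          | ^-distribˡ-+-* 2 c (d + (p + d)) | ^-distribˡ-+-* 2 d (p + d) | ^-distribˡ-+-* 2 p d = refl
  regroup₁ : ∀ s A B d k t → s + (A + (B + (d + (2 * (t + k) + d)))) ≡ s + A + B + 2 * (d + k) + 2 * t
  regroup₁ = solve-∀
  regroup₂ : ∀ s A B t → s + A + B + 2 * (B + s) + 2 * t ≡ 3 * s + (A + (3 * B + 2 * t))
  regroup₂ = solve-∀
  exponent : s₂ N + (A + (B + (s₂ j + (2 * m + s₂ j)))) ≡ 3 * s₂ N + (A + X)
  exponent = begin
    s₂ N + (A + (B + (s₂ j + (2 * m + s₂ j))))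
      -- Legendre's formula splits the exponent of `4 ^ m` into `2 * t` and `2 * s₂ m`. The latter
      -- joins `2 * s₂ j`, and since `s₂ j` is `s₂ (2 * j)`, Kummer's theorem applies to
      -- `2 * j + m`.
      ≡⟨ cong (λ z → s₂ N + (A + (B + (s₂ j + (2 * z + s₂ j))))) (legendre m) ⟨
    s₂ N + (A + (B + (s₂ j + (2 * (t + s₂ m) + s₂ j))))
      ≡⟨ regroup₁ (s₂ N) A B (s₂ j) (s₂ m) t ⟩
    s₂ N + A + B + 2 * (s₂ j + s₂ m) + 2 * t
      ≡⟨ cong (λ z → s₂ N + A + B + 2 * z + 2 * t)
           (trans (cong (_+ s₂ m) (sym (s₂-double j))) (sym (kummer (2 * j) m))) ⟩
    s₂ N + A + B + 2 * (B + s₂ N) + 2 * t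
      ≡⟨ regroup₂ (s₂ N) A B t ⟩
    3 * s₂ N + (A + X) ∎
  factorisation : central N * (binom N j * dombTerm N j) ≡ 2 ^ (3 * s₂ N) * (2 ^ (A + X) * U)
  factorisation = begin
    central N * (binom N j * (binom (2 * j) m * (central j * (4 ^ (N ∸ 2 * j) * central j))))
      ≡⟨ cong (λ z → central N * (binom N j * (binom (2 * j) m * (central j * (z * central j)))))
           (trans (cong (4 ^_) (m+n∸m≡n (2 * j) m)) (^-*-assoc 2 2 m)) ⟩
    central N * (binom N j * (binom (2 * j) m * (central j * (2 ^ (2 * m) * central j))))
      ≡⟨ cong₂ (λ x y → x * (binom N j * (binom (2 * j) m * (y * (2 ^ (2 * m) * y)))))
           (trans eqx (cong (λ v → 2 ^ v * ux) (ν₂-central N))) (trans eqc (cong (λ v → 2 ^ v * uc) (ν₂-central j))) ⟩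
    (2 ^ s₂ N * ux) * (binom N j * (binom (2 * j) m * ((2 ^ s₂ j * uc) * (2 ^ (2 * m) * (2 ^ s₂ j * uc)))))
      ≡⟨ cong₂ (λ y z → (2 ^ s₂ N * ux) * (y * (z * ((2 ^ s₂ j * uc) * (2 ^ (2 * m) * (2 ^ s₂ j * uc)))))) eqy eqz ⟩
    (2 ^ s₂ N * ux) * ((2 ^ A * uy) * ((2 ^ B * uz) * ((2 ^ s₂ j * uc) * (2 ^ (2 * m) * (2 ^ s₂ j * uc)))))
      ≡⟨ collect (2 ^ s₂ N) (2 ^ A) (2 ^ B) (2 ^ s₂ j) (2 ^ (2 * m)) ux uy uz uc ⟩
    (2 ^ s₂ N * (2 ^ A * (2 ^ B * (2 ^ s₂ j * (2 ^ (2 * m) * 2 ^ s₂ j))))) * U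
      ≡⟨ cong (_* U) (powers (s₂ N) A B (s₂ j) (2 * m)) ⟩
    2 ^ (s₂ N + (A + (B + (s₂ j + (2 * m + s₂ j))))) * U
      ≡⟨ cong (λ v → 2 ^ v * U) exponent ⟩
    2 ^ (3 * s₂ N + (A + X)) * U
      ≡⟨ cong (_* U) (^-distribˡ-+-* 2 (3 * s₂ N) (A + X)) ⟩
    2 ^ (3 * s₂ N) * 2 ^ (A + X) * U
      ≡⟨ *-assoc (2 ^ (3 * s₂ N)) (2 ^ (A + X)) U ⟩
    2 ^ (3 * s₂ N) * (2 ^ (A + X) * U) ∎
  at-half : j ≡ ⌊ N /2⌋ → X ≡ 0 → 2 ^ (A + X) ≈ (if j ≡ᵇ ⌊ N /2⌋ then e N else 0)
  at-half j≡ X≡0 = begin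
    odd (2 ^ (A + X))      ≡⟨ cong (λ v → odd (2 ^ v)) (cong (A +_) X≡0) ⟩
    -- `1 * A` unfolds to `A + 0` and supplies the multiplier that `2^ν₂≈` expects.
    odd (2 ^ (1 * A))      ≡⟨ 2^ν₂≈ 0 (binom N j) (binom-positive N j) ⟩
    odd (binom N j)        ≡⟨ cong (λ h → odd (binom N h)) j≡ ⟩
    odd (e N)              ≡⟨ cong (λ b → odd (if b then e N else 0)) (dec-true (j ≟ ⌊ N /2⌋) j≡) ⟨
    odd (if j ≡ᵇ ⌊ N /2⌋ then e N else 0) ∎
  residue : ∀ m′ → m ≡ m′ → 2 ^ (A + X) ≈ (if j ≡ᵇ ⌊ N /2⌋ then e N else 0)
  residue zero refl = at-half
    (trans (sym (⌊2*n/2⌋ j)) (cong ⌊_/2⌋ (sym (+-identityʳ (2 * j)))))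
    (cong (λ z → 3 * ν₂ z + 0) (binom-zeroʳ (2 * j)))
  -- `binom (2 * j) 1` is the odd number 2j + 1, so this case still attains the minimum.
  residue (suc zero) refl = at-half
    (trans (sym (⌊suc[2*n]/2⌋ j)) (cong ⌊_/2⌋ (+-comm 1 (2 * j))))
    (cong (λ z → 3 * z + 0) (ν₂-odd (binom (2 * j) 1) (trans (lucas-even-odd j 0) (cong odd (binom-zeroʳ j)))))
  -- From here on `m !` is even, so `t` is positive and so is the exponent; and `2 * j` falls short
  -- of `N` by at least 2, so `j` is not the half.
  residue (suc (suc m′)) refl = trans
    (odd-2^ (A + X) (≤-trans t≥1 (≤-trans (m≤m+n t _) (≤-trans (m≤n+m (2 * t) (3 * B)) (m≤n+m X A)))))
    (cong (λ b → odd (if b then e N else 0)) (sym (dec-false (j ≟ ⌊ N /2⌋) j≢)))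
    where
    consecutive : ∀ n → odd (suc n) ∧ odd n ≡ false
    consecutive n with odd n
    ... | true  = refl
    ... | false = refl
    !-even : odd (m !) ≡ false
    !-even = begin
      odd ((2 + m′) * ((1 + m′) * m′ !))           ≡⟨ cong odd (sym (*-assoc (2 + m′) (1 + m′) (m′ !))) ⟩
      odd ((2 + m′) * (1 + m′) * m′ !)             ≡⟨ odd-* ((2 + m′) * (1 + m′)) (m′ !) ⟩
      odd ((2 + m′) * (1 + m′)) ∧ odd (m′ !)       ≡⟨ cong (_∧ odd (m′ !)) (trans (odd-* (2 + m′) (1 + m′)) (consecutive (suc m′))) ⟩
      false ∎
    t≥1 : 1 ≤ t
    t≥1 with v , eq ← ν₂-even (m !) (1≤n! m) !-even = ≤-trans (s≤s z≤n) (≤-reflexive (sym eq))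
    expand₁ : ∀ j k → 2 * j + (2 + 2 * k) ≡ 2 * (j + suc k)
    expand₁ = solve-∀
    expand₂ : ∀ j k → 2 * j + (3 + 2 * k) ≡ suc (2 * (j + suc k))
    expand₂ = solve-∀
    j≢ : j ≢ ⌊ N /2⌋
    j≢ j≡ with evenOrOdd m′
    ... | inj₁ (k , refl) = m≢1+m+n j (trans j≡ (trans (trans (cong ⌊_/2⌋ (expand₁ j k)) (⌊2*n/2⌋ (j + suc k))) (+-suc j k)))
    ... | inj₂ (k , refl) = m≢1+m+n j (trans j≡ (trans (trans (cong ⌊_/2⌋ (expand₂ j k)) (⌊suc[2*n]/2⌋ (j + suc k))) (+-suc j k)))

Normal-W-four : Normal 3 (W 4) e
Normal-W-four = normal
  (λ n → sumBelow (λ j → proj₁ (W-four-summand n j)) (suc n))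
  (λ n → trans (W-four n) (trans (sumBelow-cong (λ j → proj₁ (proj₂ (W-four-summand n j))) (suc n))
           (sumBelow-*ˡ (2 ^ (3 * s₂ n)) (λ j → proj₁ (W-four-summand n j)) (suc n))))
  (λ n → trans (sumBelow-≈ {λ j → proj₁ (W-four-summand n j)} {λ j → if j ≡ᵇ ⌊ n /2⌋ then e n else 0} (λ j → proj₂ (proj₂ (W-four-summand n j))) (suc n))
           (≈-reflexive (sumBelow-pick ⌊ n /2⌋ (suc n) (e n) (s≤s (⌊n/2⌋≤n n)))))

-- Doubling the dimension

-- As W d 0 = 1, the extra factor 2 ^ δ is only present at positive arguments suc n.
record PositiveNormal (δ d : ℕ) (g : ℕ → ℕ) : Set where
  constructor posNormal
  field
    quotient : ℕ → ℕ
    factors  : ∀ n → W d (suc n) ≡ 2 ^ (3 * s₂ (suc n) + δ) * quotient n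
    residue  : ∀ n → quotient n ≈ g n

-- The weight `binom i j` inside `binSum` stems from b(2i+1,2j) by Lucas, the explicit
-- `binom (suc i) j` from the carries in `suc i + j`. If both are odd, `suc i` and `j` split the 1s
-- of n+1, and the lowest 1 lies in `suc i`: otherwise i would end in 1s that overlap j. This fixes
-- one colour and breaks the symmetry between the two.
doublingResidue : (ℕ → ℕ) → ℕ → ℕ
doublingResidue f = binSum (λ i j → binom (suc i) j * (f (suc i) * f j))

double-Normal : ∀ {a f} → Normal 3 (W a) f → PositiveNormal 1 (a + a) (doublingResidue f)
double-Normal {a} {f} (normal q q-eq q-par) = posNormal (antiSum quotient) r-eq r-par
  where
  carryFactor : ℕ → ℕ → ℕ
  carryFactor i j = 2 ^ (3 * ν₂ (binom (suc i) j))
  quotient : ℕ → ℕ → ℕ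
  quotient i j = (binom (suc (2 * i)) (2 * j) * carryFactor i j) * (q (suc i) * q j)
  shuffle₁ : ∀ B x y u v → B * ((x * u) * (y * v)) ≡ (x * y) * (B * (u * v))
  shuffle₁ = solve-∀
  shuffle₂ : ∀ B x y w → (x * y) * (B * w) ≡ x * ((B * y) * w)
  shuffle₂ = solve-∀
  shuffle₃ : ∀ x y → 2 * (x * y) ≡ (x * 2) * y
  shuffle₃ = solve-∀
  term : ∀ i j → binom (suc (2 * i)) (2 * j) * (W a (suc i) * W a j) ≡ 2 ^ (3 * s₂ (suc (i + j))) * quotient i j
  term i j = begin
    B * (W a (suc i) * W a j)
      ≡⟨ cong₂ (λ x y → B * (x * y)) (q-eq (suc i)) (q-eq j) ⟩
    B * ((2 ^ (3 * s₂ (suc i)) * q (suc i)) * (2 ^ (3 * s₂ j) * q j))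
      ≡⟨ shuffle₁ B (2 ^ (3 * s₂ (suc i))) (2 ^ (3 * s₂ j)) (q (suc i)) (q j) ⟩
    (2 ^ (3 * s₂ (suc i)) * 2 ^ (3 * s₂ j)) * (B * (q (suc i) * q j))
      ≡⟨ cong (_* (B * (q (suc i) * q j))) (2^-kummer 3 (suc i) j) ⟩
    (2 ^ (3 * s₂ (suc (i + j))) * carryFactor i j) * (B * (q (suc i) * q j))
      ≡⟨ shuffle₂ B (2 ^ (3 * s₂ (suc (i + j)))) (carryFactor i j) (q (suc i) * q j) ⟩
    2 ^ (3 * s₂ (suc (i + j))) * quotient i j ∎
    where B = binom (suc (2 * i)) (2 * j)
  r-eq : ∀ n → W (a + a) (suc n) ≡ 2 ^ (3 * s₂ (suc n) + 1) * antiSum quotient n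
  r-eq n = begin
    W (a + a) (suc n)
      ≡⟨ W-double a n ⟩
    2 * antiSum (λ i j → binom (suc (2 * i)) (2 * j) * (W a (suc i) * W a j)) n
      ≡⟨ cong (2 *_) (trans (antiSum-cong n (λ { i j refl → term i j })) (antiSum-*ˡ (2 ^ (3 * s₂ (suc n))) quotient n)) ⟩
    2 * (2 ^ (3 * s₂ (suc n)) * antiSum quotient n)
      ≡⟨ shuffle₃ (2 ^ (3 * s₂ (suc n))) (antiSum quotient n) ⟩
    (2 ^ (3 * s₂ (suc n)) * 2) * antiSum quotient n
      ≡⟨ cong (_* antiSum quotient n) (^-distribˡ-+-* 2 (3 * s₂ (suc n)) 1) ⟨
    2 ^ (3 * s₂ (suc n) + 1) * antiSum quotient n ∎
  r-par : ∀ n → antiSum quotient n ≈ doublingResidue f n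
  r-par n = trans
    (antiSum-≈ {quotient} {λ i j → binom i j * (binom (suc i) j * (f (suc i) * f j))} n λ i j _ → trans
      (≈-* {binom (suc (2 * i)) (2 * j) * carryFactor i j} {binom i j * binom (suc i) j}
        (≈-* {binom (suc (2 * i)) (2 * j)} {binom i j} {b′ = binom (suc i) j} (lucas-odd-even i j) (2^ν₂≈ 2 (binom (suc i) j) (binom-positive (suc i) j)))
        (≈-* {q (suc i)} {f (suc i)} (q-par (suc i)) (q-par j)))
      (≈-reflexive (*-assoc (binom i j) (binom (suc i) j) (f (suc i) * f j))))
    (≈-reflexive (sym (binSum≡antiSum (λ i j → binom (suc i) j * (f (suc i) * f j)) n)))

-- In `W-double` the summand j = 0 is `W a (suc n)` itself, because `W a 0` is 1. In all other
-- summands both arguments are positive, so the factor `2 ^ suc δ` occurs twice and the surplus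
-- makes them even relative to the first.
double-PositiveNormal : ∀ {δ a g} → PositiveNormal (suc δ) a g → PositiveNormal (2 + δ) (a + a) g
double-PositiveNormal {δ} {a} {g} (posNormal q q-eq q-par) =
  posNormal (λ n → q n + 2 * extra n) r-eq
    (λ n → trans (≈-+ {q n} {q n} {2 * extra n} {0} refl (odd-double (extra n)))
                 (trans (≈-reflexive (+-identityʳ (q n))) (q-par n)))
  where
  summand : ℕ → ℕ → ℕ
  summand i j = binom (suc (2 * i)) (2 * j) * (W a (suc i) * W a j)
  quotient : ℕ → ℕ → ℕ
  quotient i j = binom (suc (2 * i)) (2 * suc j) * (2 ^ (3 * ν₂ (binom (suc i) (suc j))) * (2 ^ δ * (q i * q j)))
  extra : ℕ → ℕ
  -- At n = 0 the summand with j = 0 is the only one.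
  extra zero    = 0
  extra (suc n) = antiSum quotient n
  shuffle₁ : ∀ B x y t u v → B * ((x * (2 * t) * u) * (y * (2 * t) * v)) ≡ (x * y) * (2 * t) * (2 * (B * (t * (u * v))))
  shuffle₁ = solve-∀
  shuffle₂ : ∀ B x y t w → (x * y) * (2 * t) * (2 * (B * (t * w))) ≡ (x * (2 * t) * 2) * (B * (y * (t * w)))
  shuffle₂ = solve-∀
  split : ∀ v → 2 ^ (v + suc δ) ≡ 2 ^ v * (2 * 2 ^ δ)
  split v = ^-distribˡ-+-* 2 v (suc δ)
  term : ∀ i j → summand i (suc j) ≡ (2 ^ (3 * s₂ (suc (i + suc j)) + suc δ) * 2) * quotient i j
  term i j = begin
    B * (W a (suc i) * W a (suc j))
      ≡⟨ cong₂ (λ x y → B * (x * y)) (trans (q-eq i) (cong (_* q i) (split (3 * s₂ (suc i)))))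
                                     (trans (q-eq j) (cong (_* q j) (split (3 * s₂ (suc j))))) ⟩
    B * ((2 ^ (3 * s₂ (suc i)) * (2 * 2 ^ δ) * q i) * (2 ^ (3 * s₂ (suc j)) * (2 * 2 ^ δ) * q j))
      ≡⟨ shuffle₁ B (2 ^ (3 * s₂ (suc i))) (2 ^ (3 * s₂ (suc j))) (2 ^ δ) (q i) (q j) ⟩
    (2 ^ (3 * s₂ (suc i)) * 2 ^ (3 * s₂ (suc j))) * (2 * 2 ^ δ) * (2 * (B * (2 ^ δ * (q i * q j))))
      ≡⟨ cong (λ z → z * (2 * 2 ^ δ) * (2 * (B * (2 ^ δ * (q i * q j))))) (2^-kummer 3 (suc i) (suc j)) ⟩
    (2 ^ (3 * s₂ (suc (i + suc j))) * K) * (2 * 2 ^ δ) * (2 * (B * (2 ^ δ * (q i * q j))))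
      ≡⟨ shuffle₂ B (2 ^ (3 * s₂ (suc (i + suc j)))) K (2 ^ δ) (q i * q j) ⟩
    (2 ^ (3 * s₂ (suc (i + suc j))) * (2 * 2 ^ δ) * 2) * (B * (K * (2 ^ δ * (q i * q j))))
      ≡⟨ cong (λ z → (z * 2) * quotient i j) (split (3 * s₂ (suc (i + suc j)))) ⟨
    (2 ^ (3 * s₂ (suc (i + suc j)) + suc δ) * 2) * quotient i j ∎
    where
    B = binom (suc (2 * i)) (2 * suc j)
    K = 2 ^ (3 * ν₂ (binom (suc i) (suc j)))
  last : ∀ n → summand n 0 ≡ 2 ^ (3 * s₂ (suc n) + suc δ) * q n
  last n = begin
    binom (suc (2 * n)) 0 * (W a (suc n) * W a 0)   ≡⟨ cong₂ (λ x y → x * (W a (suc n) * y)) (binom-zeroʳ (suc (2 * n))) (W-0 a) ⟩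
    1 * (W a (suc n) * 1)                           ≡⟨ trans (*-identityˡ _) (*-identityʳ _) ⟩
    W a (suc n)                                     ≡⟨ q-eq n ⟩
    2 ^ (3 * s₂ (suc n) + suc δ) * q n              ∎
  shuffle₃ : ∀ x u v → (x * 2) * v + x * u ≡ x * (u + 2 * v)
  shuffle₃ = solve-∀
  total : ∀ n → antiSum summand n ≡ 2 ^ (3 * s₂ (suc n) + suc δ) * (q n + 2 * extra n)
  total zero    = trans (last 0) (cong (2 ^ (3 * s₂ 1 + suc δ) *_) (sym (+-identityʳ (q 0))))
  total (suc n) = begin
    antiSum summand (suc n)
      ≡⟨ antiSum-sucʳ summand n ⟩
    antiSum (λ i j → summand i (suc j)) n + summand (suc n) 0
      ≡⟨ cong₂ _+_ (trans (antiSum-cong n (λ { i j refl → trans (term i j)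
             (cong (λ z → (2 ^ (3 * s₂ (suc z) + suc δ) * 2) * quotient i j) (+-suc i j)) }))
           (antiSum-*ˡ (P * 2) quotient n)) (last (suc n)) ⟩
    (P * 2) * antiSum quotient n + P * q (suc n)
      ≡⟨ shuffle₃ P (q (suc n)) (antiSum quotient n) ⟩
    P * (q (suc n) + 2 * antiSum quotient n) ∎
    where P = 2 ^ (3 * s₂ (2 + n) + suc δ)
  r-eq : ∀ n → W (a + a) (suc n) ≡ 2 ^ (3 * s₂ (suc n) + (2 + δ)) * (q n + 2 * extra n)
  r-eq n = begin
    W (a + a) (suc n)                                             ≡⟨ W-double a n ⟩
    2 * antiSum summand n                                         ≡⟨ cong (2 *_) (total n) ⟩
    2 * (2 ^ (3 * s₂ (suc n) + suc δ) * (q n + 2 * extra n))      ≡⟨ *-assoc 2 (2 ^ (3 * s₂ (suc n) + suc δ)) _ ⟨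
    2 ^ suc (3 * s₂ (suc n) + suc δ) * (q n + 2 * extra n)        ≡⟨ cong (λ v → 2 ^ v * (q n + 2 * extra n)) (+-suc (3 * s₂ (suc n)) (suc δ)) ⟨
    2 ^ (3 * s₂ (suc n) + (2 + δ)) * (q n + 2 * extra n)          ∎

-- Counting two-colourings of the 1s modulo 2

runResidue : ℕ → ℕ
runResidue = (λ i → e (suc (2 * i))) ⋆ e

-- The argument stands for its successor, so this removes the final 0 of `2 * suc n`. The mixed
-- summands die because `suc (2 * i)` and `suc (2 * j)` collide in the last digit.
doublingResidue-odd : ∀ n → doublingResidue e (suc (2 * n)) ≈ doublingResidue e n
doublingResidue-odd n = begin
  odd (doublingResidue e (suc (2 * n)))
    ≡⟨ binSum-odd F n ⟩
  odd (binSum (λ i j → F (suc (2 * i)) (2 * j)) n + binSum (λ i j → F (2 * i) (suc (2 * j))) n)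
    ≡⟨ ≈-+ {binSum (λ i j → F (suc (2 * i)) (2 * j)) n} {binSum F n} {b′ = 0} (binSum-≈ main n)
         (trans (binSum-≈ {G = λ _ _ → 0} cross n) (≈-reflexive (binSum-zero (λ _ _ → refl) n))) ⟩
  odd (binSum F n + 0)
    ≡⟨ cong odd (+-identityʳ (binSum F n)) ⟩
  odd (binSum F n) ∎
  where
  F : ℕ → ℕ → ℕ
  F i j = binom (suc i) j * (e (suc i) * e j)
  main : ∀ i j → F (suc (2 * i)) (2 * j) ≈ F i j
  main i j = trans (cong (λ m → odd (binom m (2 * j) * (e m * e (2 * j)))) (sym (*-suc 2 i)))
    (≈-* {binom (2 * suc i) (2 * j)} {binom (suc i) j} (lucas-even-even (suc i) j)
      (≈-* {e (2 * suc i)} {e (suc i)} (e-double (suc i)) (e-double j)))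
  cross : ∀ i j → F (2 * i) (suc (2 * j)) ≈ 0
  cross i j = ≈0-* (binom (suc (2 * i)) (suc (2 * j))) (e (suc (2 * i)) * e (suc (2 * j))) (lucas-odd-odd i j)

binSum-binom : ∀ G n → binSum (λ i j → binom i j * G i j) n ≈ binSum G n
binSum-binom G n = begin
  odd (binSum (λ i j → binom i j * G i j) n)
    ≡⟨ cong odd (binSum≡antiSum (λ i j → binom i j * G i j) n) ⟩
  odd (antiSum (λ i j → binom i j * (binom i j * G i j)) n)
    ≡⟨ antiSum-≈ {G = λ i j → binom i j * G i j} n (λ i j _ →
         trans (cong odd (sym (*-assoc (binom i j) (binom i j) (G i j))))
               (≈-* {binom i j * binom i j} {binom i j} {G i j} (x*x≈x (binom i j)) refl)) ⟩
  odd (antiSum (λ i j → binom i j * G i j) n)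
    ≡⟨ cong odd (binSum≡antiSum G n) ⟨
  odd (binSum G n) ∎

-- The number concerned is 2n + 1, whose final 1 has the first colour. `runResidue n` counts the
-- colourings of the remaining digits, with that 1 appended to the first class.
doublingResidue-even : ∀ n → doublingResidue e (2 * n) ≈ runResidue n
doublingResidue-even n = begin
  odd (doublingResidue e (2 * n))
    ≡⟨ binSum-even (λ i j → binom (suc i) j * (e (suc i) * e j)) n ⟩
  odd (binSum (λ i j → binom (suc (2 * i)) (2 * j) * (e (suc (2 * i)) * e (2 * j))) n)
    ≡⟨ binSum-≈ (λ i j → ≈-* {binom (suc (2 * i)) (2 * j)} {binom i j} (lucas-odd-even i j)
         (≈-* {e (suc (2 * i))} {e (suc (2 * i))} refl (e-double j))) n ⟩
  odd (binSum (λ i j → binom i j * (e (suc (2 * i)) * e j)) n)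
    ≡⟨ binSum-binom (λ i j → e (suc (2 * i)) * e j) n ⟩
  odd (runResidue n) ∎

-- A 0 next to the appended 1 ends the run and frees the colours above it; exchanging the colours
-- then pairs off all colourings unless no digit 1 is left.
runResidue-even : ∀ n → runResidue (2 * n) ≈ δ₀ n
runResidue-even n = begin
  odd (runResidue (2 * n))
    ≡⟨ binSum-even (λ i j → e (suc (2 * i)) * e j) n ⟩
  odd (binSum (λ i j → e (suc (2 * (2 * i))) * e (2 * j)) n)
    ≡⟨ binSum-≈ (λ i j → ≈-* {e (suc (2 * (2 * i)))} {e i} (e-4k+1 i) (e-double j)) n ⟩
  odd ((e ⋆ e) n)
    ≡⟨ ⋆-square≈δ₀ e refl n ⟩
  odd (δ₀ n) ∎

-- A 1 next to the appended 1 has to take the other colour, the same colour being ruled out by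
-- `e-4k+3`. The situation repeats with the colours exchanged, hence `⋆-comm`.
runResidue-odd : ∀ n → runResidue (suc (2 * n)) ≈ runResidue n
runResidue-odd n = begin
  odd (runResidue (suc (2 * n)))
    ≡⟨ binSum-odd (λ i j → e (suc (2 * i)) * e j) n ⟩
  odd (binSum (λ i j → e (suc (2 * suc (2 * i))) * e (2 * j)) n + binSum (λ i j → e (suc (2 * (2 * i))) * e (suc (2 * j))) n)
    ≡⟨ ≈-+ {binSum (λ i j → e (suc (2 * suc (2 * i))) * e (2 * j)) n} {0} {b′ = (e ⋆ (λ j → e (suc (2 * j)))) n}
         (trans (binSum-≈ {G = λ _ _ → 0} (λ i j → ≈0-* (e (suc (2 * suc (2 * i)))) (e (2 * j)) (e-4k+3 i)) n)
                (≈-reflexive (binSum-zero (λ _ _ → refl) n)))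
         (binSum-≈ (λ i j → ≈-* {e (suc (2 * (2 * i)))} {e i} {e (suc (2 * j))} (e-4k+1 i) refl) n) ⟩
  odd ((e ⋆ (λ j → e (suc (2 * j)))) n)
    ≡⟨ cong odd (⋆-comm e (λ j → e (suc (2 * j))) n) ⟩
  odd (runResidue n) ∎

-- The tests below read the digits from the least significant one.
noAdjacentOnes : List Bool → Bool
noAdjacentOnes []                  = true
noAdjacentOnes (false ∷ xs)        = noAdjacentOnes xs
noAdjacentOnes (true ∷ [])         = true
noAdjacentOnes (true ∷ true ∷ xs)  = false
noAdjacentOnes (true ∷ false ∷ xs) = noAdjacentOnes xs

allOnes : List Bool → Bool
allOnes []           = true
allOnes (true ∷ xs)  = allOnes xs
allOnes (false ∷ xs) = false

zerosThenOnes : List Bool → Bool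
zerosThenOnes []           = true
zerosThenOnes (false ∷ xs) = zerosThenOnes xs
zerosThenOnes (true ∷ xs)  = allOnes xs

private
  n≤2n : ∀ n → n ≤ 2 * n
  n≤2n n = m≤m+n n (n + 0)

  odd-e-below : ∀ f n → n ≤ f → odd (e n) ≡ noAdjacentOnes (bits n)
  odd-e-below f n n≤f with evenOrOdd n
  odd-e-below f n n≤f | inj₁ (zero , refl) = refl
  odd-e-below (suc f) n n≤f | inj₁ (suc k , refl) = trans (e-double (suc k))
    (trans (odd-e-below f (suc k) (s≤s⁻¹ (≤-trans (m<m+n (suc k) (s≤s z≤n)) n≤f)))
           (cong noAdjacentOnes (sym (bits-double k))))
  odd-e-below (suc f) n n≤f | inj₂ (k , refl) with evenOrOdd k
  ... | inj₂ (l , refl) = trans (e-4k+3 l) (cong noAdjacentOnes (sym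
          (trans (bits-suc-double (suc (2 * l))) (cong (true ∷_) (bits-suc-double l)))))
  ... | inj₁ (zero , refl) = refl
  ... | inj₁ (suc l , refl) = trans (e-4k+1 (suc l))
          (trans (odd-e-below f (suc l) (≤-trans (n≤2n (suc l)) (≤-trans (n≤2n (2 * suc l)) (s≤s⁻¹ n≤f))))
            (cong noAdjacentOnes (sym (trans (bits-suc-double (2 * suc l)) (cong (true ∷_) (bits-double l))))))

  odd-runResidue-below : ∀ f n → n ≤ f → odd (runResidue n) ≡ allOnes (bits n)
  odd-runResidue-below f n n≤f with evenOrOdd n
  odd-runResidue-below f n n≤f | inj₁ (zero , refl) = refl
  odd-runResidue-below f n n≤f | inj₁ (suc k , refl) =
    trans (runResidue-even (suc k)) (cong allOnes (sym (bits-double k)))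
  odd-runResidue-below (suc f) n n≤f | inj₂ (k , refl) = trans (runResidue-odd k)
    (trans (odd-runResidue-below f k (≤-trans (n≤2n k) (s≤s⁻¹ n≤f))) (cong allOnes (sym (bits-suc-double k))))

  odd-doublingResidue-below : ∀ f n → n ≤ f → odd (doublingResidue e n) ≡ zerosThenOnes (bits (suc n))
  odd-doublingResidue-below f n n≤f with evenOrOdd n
  odd-doublingResidue-below f n n≤f | inj₁ (k , refl) = trans (doublingResidue-even k)
    (trans (odd-runResidue-below k k ≤-refl) (cong zerosThenOnes (sym (bits-suc-double k))))
  odd-doublingResidue-below (suc f) n n≤f | inj₂ (k , refl) = trans (doublingResidue-odd k)
    (trans (odd-doublingResidue-below f k (≤-trans (n≤2n k) (s≤s⁻¹ n≤f)))
      (cong zerosThenOnes (sym (trans (cong bits (sym (*-suc 2 k))) (bits-double k)))))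

odd-e : ∀ n → odd (e n) ≡ noAdjacentOnes (bits n)
odd-e n = odd-e-below n n ≤-refl

odd-doublingResidue : ∀ n → odd (doublingResidue e n) ≡ zerosThenOnes (bits (suc n))
odd-doublingResidue n = odd-doublingResidue-below n n ≤-refl

-- From the digit tests to the conditions on the binary expansion

noAdjacentOnes-++ : ∀ xs ys → noAdjacentOnes (xs ++ true ∷ true ∷ ys) ≡ false
noAdjacentOnes-++ []                  ys = refl
noAdjacentOnes-++ (false ∷ xs)        ys = noAdjacentOnes-++ xs ys
noAdjacentOnes-++ (true ∷ [])         ys = refl
noAdjacentOnes-++ (true ∷ true ∷ xs)  ys = refl
noAdjacentOnes-++ (true ∷ false ∷ xs) ys = noAdjacentOnes-++ xs ys

noAdjacentOnes-false : ∀ zs → noAdjacentOnes zs ≡ false → ∃₂ λ xs ys → zs ≡ xs ++ true ∷ true ∷ ys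
noAdjacentOnes-false (false ∷ zs) h with xs , ys , refl ← noAdjacentOnes-false zs h = false ∷ xs , ys , refl
noAdjacentOnes-false (true ∷ true ∷ zs) h = [] , zs , refl
noAdjacentOnes-false (true ∷ false ∷ zs) h with xs , ys , refl ← noAdjacentOnes-false zs h = true ∷ false ∷ xs , ys , refl

reverse-adjacentOnes : ∀ (xs ys : List Bool) →
  reverse (xs ++ true ∷ true ∷ ys) ≡ reverse ys ++ true ∷ true ∷ reverse xs
reverse-adjacentOnes xs ys = begin
  reverse (xs ++ true ∷ true ∷ ys)                      ≡⟨ reverse-++ xs (true ∷ true ∷ ys) ⟩
  reverse ((true ∷ true ∷ []) ++ ys) ++ reverse xs      ≡⟨ cong (_++ reverse xs) (reverse-++ (true ∷ true ∷ []) ys) ⟩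
  (reverse ys ++ true ∷ true ∷ []) ++ reverse xs        ≡⟨ ++-assoc (reverse ys) (true ∷ true ∷ []) (reverse xs) ⟩
  reverse ys ++ true ∷ true ∷ reverse xs                ∎

reverse-binary : ∀ n → reverse (binary n) ≡ bits n
reverse-binary n = reverse-involutive (bits n)

NoAdjacentOnes⇔ : ∀ n → noAdjacentOnes (bits n) ≡ true ⇔ NoAdjacentOnes n
NoAdjacentOnes⇔ n = mk⇔ to from
  where
  to : noAdjacentOnes (bits n) ≡ true → NoAdjacentOnes n
  to h (xs , ys , eq) with () ← trans (sym h) (trans
    (cong noAdjacentOnes (trans (sym (reverse-binary n)) (trans (cong reverse eq) (reverse-adjacentOnes xs ys))))
    (noAdjacentOnes-++ (reverse ys) (reverse xs)))
  from : NoAdjacentOnes n → noAdjacentOnes (bits n) ≡ true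
  from h with noAdjacentOnes (bits n) in eq
  ... | true  = refl
  ... | false with xs , ys , eq′ ← noAdjacentOnes-false (bits n) eq =
    ⊥-elim (h (reverse ys , reverse xs , trans (cong reverse eq′) (reverse-adjacentOnes xs ys)))

reverse-replicate : ∀ a (b : Bool) → reverse (replicate a b) ≡ replicate a b
reverse-replicate zero    b = refl
reverse-replicate (suc a) b = trans (unfold-reverse b (replicate a b))
  (trans (cong (_++ b ∷ []) (reverse-replicate a b)) (replicate-snoc a))
  where
  replicate-snoc : ∀ a → replicate a b ++ b ∷ [] ≡ b ∷ replicate a b
  replicate-snoc zero    = refl
  replicate-snoc (suc a) = cong (b ∷_) (replicate-snoc a)

allOnes-replicate : ∀ a → allOnes (replicate a true) ≡ true
allOnes-replicate zero    = refl
allOnes-replicate (suc a) = allOnes-replicate a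

zerosThenOnes-replicate : ∀ b a → zerosThenOnes (replicate b false ++ replicate a true) ≡ true
zerosThenOnes-replicate zero    zero    = refl
zerosThenOnes-replicate zero    (suc a) = allOnes-replicate a
zerosThenOnes-replicate (suc b) a       = zerosThenOnes-replicate b a

allOnes-true : ∀ xs → allOnes xs ≡ true → ∃ λ a → xs ≡ replicate a true
allOnes-true []          h = 0 , refl
allOnes-true (true ∷ xs) h with a , refl ← allOnes-true xs h = suc a , refl

zerosThenOnes-true : ∀ xs → zerosThenOnes xs ≡ true → ∃₂ λ b a → xs ≡ replicate b false ++ replicate a true
zerosThenOnes-true []           h = 0 , 0 , refl
zerosThenOnes-true (false ∷ xs) h with b , a , refl ← zerosThenOnes-true xs h = suc b , a , refl
zerosThenOnes-true (true ∷ xs)  h with a , refl ← allOnes-true xs h = 0 , suc a , refl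

reverse-blocks : ∀ a b (x y : Bool) → reverse (replicate a x ++ replicate b y) ≡ replicate b y ++ replicate a x
reverse-blocks a b x y = trans (reverse-++ (replicate a x) (replicate b y))
  (cong₂ _++_ (reverse-replicate b y) (reverse-replicate a x))

OnesBeforeZeros⇔ : ∀ n → zerosThenOnes (bits n) ≡ true ⇔ OnesBeforeZeros n
OnesBeforeZeros⇔ n = mk⇔ to from
  where
  to : zerosThenOnes (bits n) ≡ true → OnesBeforeZeros n
  to h with b , a , eq ← zerosThenOnes-true (bits n) h =
    a , b , trans (cong reverse eq) (reverse-blocks b a false true)
  from : OnesBeforeZeros n → zerosThenOnes (bits n) ≡ true
  from (a , b , eq) = trans
    (cong zerosThenOnes (trans (sym (reverse-binary n)) (trans (cong reverse eq) (reverse-blocks a b true false))))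
    (zerosThenOnes-replicate b a)

-- Valuations and equality cases

ν₂-2^*-bound : ∀ w v q → 1 ≤ w → w ≡ 2 ^ v * q → v ≤ ν₂ w × (ν₂ w ≡ v ⇔ odd q ≡ true)
-- Positivity of `w` excludes the quotient 0, for which the convention that `ν₂ 0` is 0 would break
-- the bound.
ν₂-2^*-bound w v zero 1≤w eq with () ← ≤-trans 1≤w (≤-reflexive (trans eq (*-zeroʳ (2 ^ v))))
ν₂-2^*-bound w v (suc q) 1≤w refl = subst (v ≤_) (sym val) (m≤m+n v _) , mk⇔ to from
  where
  val : ν₂ (2 ^ v * suc q) ≡ v + ν₂ (suc q)
  val = trans (ν₂-* (2 ^ v) (suc q) (2^-positive v) (s≤s z≤n))
    (cong (_+ ν₂ (suc q)) (trans (cong ν₂ (sym (*-identityʳ (2 ^ v)))) (ν₂-2^* v 1 refl)))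
  to : ν₂ (2 ^ v * suc q) ≡ v → odd (suc q) ≡ true
  to h with odd (suc q) in eq
  ... | true  = refl
  ... | false with u , eqν ← ν₂-even (suc q) (s≤s z≤n) eq =
    ⊥-elim (m≢1+m+n v (trans (sym h) (trans val (trans (cong (v +_) eqν) (+-suc v u)))))
  from : odd (suc q) ≡ true → ν₂ (2 ^ v * suc q) ≡ v
  from h = ν₂-2^* v (suc q) h

odd-decompose : ∀ d → 1 ≤ d → ∃ λ k → d ≡ 2 ^ ν₂ d * suc (2 * k)
odd-decompose d 1≤d with u , h , eq ← ν₂-decompose d 1≤d with k , refl ← odd⇒suc-double u h = k , eq

Normal-W-2^2 : ∀ k → Normal 3 (W (2 ^ 2 * suc (2 * k))) e
Normal-W-2^2 k = subst (λ d → Normal 3 (W d) e) (*-comm (suc (2 * k)) 4) (Normal-W-odd-* {a = 4} refl Normal-W-four k)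

-- The odd factor is absorbed at 4(2k+1), where the residues still combine by ⋆; every later step is
-- a doubling. The first doubling produces the residue and the others preserve it.
PositiveNormal-W-2^3+ : ∀ t k → PositiveNormal (suc t) (2 ^ (3 + t) * suc (2 * k)) (doublingResidue e)
PositiveNormal-W-2^3+ zero k = subst (λ d → PositiveNormal 1 d (doublingResidue e)) (regroup (suc (2 * k)))
  (double-Normal (Normal-W-2^2 k))
  where
  regroup : ∀ u → 4 * u + 4 * u ≡ 8 * u
  regroup = solve-∀
PositiveNormal-W-2^3+ (suc t) k = subst (λ d → PositiveNormal (2 + t) d (doublingResidue e)) (regroup (2 ^ (3 + t)) (suc (2 * k)))
  (double-PositiveNormal (PositiveNormal-W-2^3+ t k))
  where
  regroup : ∀ p u → p * u + p * u ≡ 2 * p * u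
  regroup = solve-∀

mainTheorem1 : (d n : ℕ) → 1 ≤ d → 1 ≤ n →
    (ν₂ d ≡ 0 → ν₂ (W d n) ≡ s₂ n)
    × (ν₂ d ≡ 1 → ν₂ (W d n) ≡ 2 * s₂ n)
    × (ν₂ d ≡ 2 → (3 * s₂ n ≤ ν₂ (W d n))
    × ((ν₂ (W d n) ≡ 3 * s₂ n) ⇔ NoAdjacentOnes n))
    × (3 ≤ ν₂ d → (3 * s₂ n + (ν₂ d ∸ 2) ≤ ν₂ (W d n))
    × ((ν₂ (W d n) ≡ 3 * s₂ n + (ν₂ d ∸ 2)) ⇔ OnesBeforeZeros n))
mainTheorem1 d@(suc _) n@(suc n-1) 1≤d 1≤n with k , d≡ ← odd-decompose d 1≤d = caseA , caseB , caseC , caseD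
  where
  u = suc (2 * k)
  d-factored : ∀ {v} → ν₂ d ≡ v → d ≡ 2 ^ v * u
  d-factored refl = d≡
  exact : ∀ c a → Normal (suc c) (W a) (λ _ → 1) → d ≡ a * u → ν₂ (W d n) ≡ suc c * s₂ n
  exact c a N d≡au with normal q eq par ← subst (λ m → Normal (suc c) (W m) (λ _ → 1)) (trans (*-comm u a) (sym d≡au)) (Normal-W-odd-* refl N k) =
    trans (cong ν₂ (eq n)) (ν₂-2^* (suc c * s₂ n) (q n) (par n))
  caseA : ν₂ d ≡ 0 → ν₂ (W d n) ≡ s₂ n
  caseA h = trans (exact 0 1 Normal-W-one (d-factored h)) (*-identityˡ (s₂ n))
  caseB : ν₂ d ≡ 1 → ν₂ (W d n) ≡ 2 * s₂ n
  caseB h = exact 1 2 Normal-W-two (d-factored h)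
  caseC : ν₂ d ≡ 2 → (3 * s₂ n ≤ ν₂ (W d n)) × ((ν₂ (W d n) ≡ 3 * s₂ n) ⇔ NoAdjacentOnes n)
  caseC h with normal q eq par ← subst (λ m → Normal 3 (W m) e) (sym (d-factored h)) (Normal-W-2^2 k)
    with lower , equality ← ν₂-2^*-bound (W d n) (3 * s₂ n) (q n) (W-positive _ n) (eq n) =
    lower , NoAdjacentOnes⇔ n ⇔-∘ subst (λ b → _ ⇔ b ≡ true) (trans (par n) (odd-e n)) equality
  caseD : 3 ≤ ν₂ d → (3 * s₂ n + (ν₂ d ∸ 2) ≤ ν₂ (W d n)) × ((ν₂ (W d n) ≡ 3 * s₂ n + (ν₂ d ∸ 2)) ⇔ OnesBeforeZeros n)
  caseD h with t , 3+t≡ ← m≤n⇒∃[o]m+o≡n h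
    with posNormal q eq par ← subst (λ m → PositiveNormal (suc t) m (doublingResidue e)) (sym (d-factored (sym 3+t≡))) (PositiveNormal-W-2^3+ t k)
    with lower , equality ← ν₂-2^*-bound (W d n) (3 * s₂ n + suc t) (q n-1) (W-positive _ n) (eq n-1)
    -- At `v = 3 + t` the truncated difference computes to `suc t`, the exponent delivered by the
    -- normal form.
    = subst (λ v → (3 * s₂ n + (v ∸ 2) ≤ ν₂ (W d n)) × ((ν₂ (W d n) ≡ 3 * s₂ n + (v ∸ 2)) ⇔ OnesBeforeZeros n)) 3+t≡
        (lower , OnesBeforeZeros⇔ n ⇔-∘ subst (λ b → _ ⇔ b ≡ true) (trans (par n-1) (odd-doublingResidue n-1)) equality)
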